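{- For all nonnegative integers $n,k,\ell,m$, the number $B(n,k,\ell,m)$ of permutations $\sigma$ of $[n]$ with $k$ weak exceedances, $\ell$ crossings and $m$ nestings is equal to the number $D(n,k,\ell,m)$ of permutations of $[n]$ with $n-k$ descents, $\ell$ occurrences of the pattern $31\text{ - }2$ and $m$ occurrences of the pattern $2\text{ - }31$.
   Context: Let $\sigma$ be a permutation of $[n]=\{1,\dots,n\}$. The number of weak exceedances of $\sigma$ is $|\{j : \sigma(j)\ge j\}|$. For $i\in[n]$ let $C_+(i)=\{j : j<i\le \sigma(j)<\sigma(i)\}$, $C_-(i)=\{j : j>i>\sigma(j)>\sigma(i)\}$, $A_+(i)=\{j : j<i\le\sigma(i)<\sigma(j)\}$, $A_-(i)=\{j : j>i>\sigma(i)>\sigma(j)\}$, and set $C_\pm(\sigma)=\sum_{i=1}^n|C_\pm(i)|$, $A_\pm(\sigma)=\sum_{i=1}^n |A_\pm(i)|$. The number of crossings of $\sigma$ is $C_+(\sigma)+C_-(\sigma)$ and the number of nestings is $A_+(\sigma)+A_-(\sigma)$. A descent of $\sigma$ is an index $i$ with $\sigma(i)>\sigma(i+1)$. The number of occurrences of the pattern $31\text{ - }2$ in $\sigma$ is the number of pairs $i<j$ with $\sigma(i)>\sigma(j)>\sigma(i+1)$; the number of occurrences of $2\text{ - }31$ is the number of pairs $i<j$ with $\sigma(j+1)<\sigma(i)<\sigma(j)$. For $n=0$ the only permutation is the empty one. -}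

module Defs where

open import Data.Nat using (ℕ; zero; suc; _+_; _∸_; _≤_; _<_)
import Data.Nat as ℕ
open import Data.Fin using (Fin; toℕ; _≟_)
open import Data.Fin.Properties using (all?)
open import Data.Vec using (Vec; []; _∷_; lookup)
open import Data.List using (List; []; _∷_; map; concatMap; length; filter; allFin)
open import Data.Product using (_×_; _,_)
open import Relation.Nullary using (Dec)
open import Relation.Nullary.Decidable using (_×-dec_; _→-dec_)
open import Relation.Unary using (Pred; Decidable)
open import Relation.Binary.PropositionalEquality using (_≡_)

-- Permutations of [n] in one-line notation.
-- A word w ∈ Vec (Fin n) n is read as the map σ : i ↦ w[i] on
-- {0,…,n-1}; setting σ'(i+1) = σ(i) + 1 identifies it with a map
-- [n] → [n].  All statistics below only compare positions with positions
-- and values with values (or positions with values, where both are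
-- shifted by the same amount), so 0-based indexing is immaterial.

words : (m n : ℕ) → List (Vec (Fin m) n)
words m zero    = [] ∷ []
words m (suc n) = concatMap (λ a → map (a ∷_) (words m n)) (allFin m)

IsPerm : ∀ {n} → Vec (Fin n) n → Set
IsPerm {n} w = ∀ (i j : Fin n) → lookup w i ≡ lookup w j → i ≡ j

isPerm? : ∀ {n} (w : Vec (Fin n) n) → Dec (IsPerm w)
isPerm? w = all? λ i → all? λ j → (lookup w i ≟ lookup w j) →-dec (i ≟ j)

perms : (n : ℕ) → List (Vec (Fin n) n)
perms n = filter isPerm? (words n n)

#_ : ∀ {n p} {P : Pred (Fin n) p} → Decidable P → ℕ
#_ {n} P? = length (filter P? (allFin n))

#₂ : ∀ {n p} {R : Fin n → Fin n → Set p} → (∀ i j → Dec (R i j)) → ℕ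
#₂ {n} R? = length (filter (λ { (i , j) → R? i j })
                          (concatMap (λ i → map (i ,_) (allFin n)) (allFin n)))

#₃ : ∀ {n p} {R : Fin n → Fin n → Fin n → Set p} → (∀ i j k → Dec (R i j k)) → ℕ
#₃ {n} R? = length (filter (λ { (i , j , k) → R? i j k })
   (concatMap (λ i → concatMap (λ j → map (λ k → i , j , k) (allFin n)) (allFin n)) (allFin n)))

module _ {n : ℕ} (w : Vec (Fin n) n) where
  private
    σ : Fin n → ℕ
    σ i = toℕ (lookup w i)
    ι : Fin n → ℕ
    ι = toℕ

  wex : ℕ
  wex = # (λ j → ι j ℕ.≤? σ j)

  crossPlus : ℕ
  crossPlus = #₂ (λ i j → (ι j ℕ.<? ι i) ×-dec (ι i ℕ.≤? σ j) ×-dec (σ j ℕ.<? σ i))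

  crossMinus : ℕ
  crossMinus = #₂ (λ i j → (ι i ℕ.<? ι j) ×-dec (σ j ℕ.<? ι i) ×-dec (σ i ℕ.<? σ j))

  nestPlus : ℕ
  nestPlus = #₂ (λ i j → (ι j ℕ.<? ι i) ×-dec (ι i ℕ.≤? σ i) ×-dec (σ i ℕ.<? σ j))

  nestMinus : ℕ
  nestMinus = #₂ (λ i j → (ι i ℕ.<? ι j) ×-dec (σ i ℕ.<? ι i) ×-dec (σ j ℕ.<? σ i))

  crossings : ℕ
  crossings = crossPlus + crossMinus

  nestings : ℕ
  nestings = nestPlus + nestMinus

  descents : ℕ
  descents = #₂ (λ i i' → (suc (ι i) ℕ.≟ ι i') ×-dec (σ i' ℕ.<? σ i))

  -- occurrences of 31-2: pairs i < j with σ(i) > σ(j) > σ(i+1);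
  -- counted as triples (i , i' , j) with i' = i + 1 (so i' is determined
  -- by i, and exists only when i + 1 is a position).
  pat31-2 : ℕ
  pat31-2 = #₃ (λ i i' j → (suc (ι i) ℕ.≟ ι i') ×-dec (ι i ℕ.<? ι j)
                           ×-dec (σ j ℕ.<? σ i) ×-dec (σ i' ℕ.<? σ j))

  pat2-31 : ℕ
  pat2-31 = #₃ (λ i j j' → (suc (ι j) ℕ.≟ ι j') ×-dec (ι i ℕ.<? ι j)
                           ×-dec (σ j' ℕ.<? σ i) ×-dec (σ i ℕ.<? σ j))

B : ℕ → ℕ → ℕ → ℕ → ℕ
B n k ℓ m = length (filter (λ w → (wex w ℕ.≟ k) ×-dec (crossings w ℕ.≟ ℓ) ×-dec (nestings w ℕ.≟ m)) (perms n))

-- D(n,k,ℓ,m): permutations of [n] with n-k descents (written as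
-- des + k = n, so that D = 0 when k > n, n-k being negative), ℓ occurrences of 31-2,
-- m occurrences of 2-31
D : ℕ → ℕ → ℕ → ℕ → ℕ
D n k ℓ m = length (filter (λ w → (descents w + k ℕ.≟ n) ×-dec (pat31-2 w ℕ.≟ ℓ) ×-dec (pat2-31 w ℕ.≟ m)) (perms n))

{-# OPTIONS --safe #-}
module Submission where

-- Encode a permutation σ by one letter (b₁, b₂, x, y) for each index v.  On the crossing side, b₁ says
-- that v is a weak exceedance, b₂ that σ⁻¹(v) ≤ v, and x, y count the crossings and nestings at v.  On
-- the pattern side v is a value; b₁ says that the letter after v is larger (or missing), b₂ that the
-- letter before v is smaller (or missing), and x, y count the occurrences of 31-2 and 2-31 in which v
-- plays the role of 2.  In both cases the bits b₁ − b₂ are the steps of a path from height 0 to height 0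
-- and x + y + 1 = h + b₁ at height h, so the code is a Laguerre history, with k = Σ b₁, ℓ = Σ x and
-- m = Σ y.  Both encodings are injective and there are exactly n! histories, hence both are bijections
-- onto the same set, compatible with the three statistics.

open import Defs
open import Algebra.Properties.CommutativeSemigroup using (interchange)
open import Data.Fin as Fin using (Fin; zero; suc; punchIn; punchOut; toℕ; fromℕ<)
open import Data.Fin.Properties using (any?; toℕ<n; toℕ-fromℕ<; toℕ-injective; injective⇒≤; punchIn-injective; punchInᵢ≢i; punchOut-injective)
open import Data.List as List using (List; []; _∷_; map; length; _++_; allFin; concatMap; cartesianProductWith; applyUpTo; filter)
import Data.List.Properties as List
open import Data.List.Properties using (length-map; length-++; length-tabulate)
open import Data.List.Membership.Propositional using (_∈_)
open import Data.List.Membership.Propositional.Properties using (∈-map⁺; ∈-++⁺ˡ; ∈-++⁺ʳ; ∈-∃++; ∈-allFin; ∈-filter⁺; ∈-filter⁻; ∈-cartesianProductWith⁺; ∈-cartesianProductWith⁻)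
open import Data.List.Relation.Binary.Permutation.Propositional using (_↭_; ↭-refl; ↭-trans; prep)
open import Data.List.Relation.Binary.Permutation.Propositional.Properties using (shift; ↭-length; ++-identityʳ; ∈-resp-↭; filter-↭)
import Data.List.Relation.Unary.All as All
import Data.List.Relation.Unary.AllPairs as AllPairs
open import Data.List.Relation.Unary.Any using (here; there)
open import Data.List.Relation.Unary.Unique.Propositional using (Unique; _∷_)
open import Data.List.Relation.Unary.Unique.Propositional.Properties as Unique using (allFin⁺; filter⁺)
open import Data.Nat
open import Data.Nat.Combinatorics using (_C_; nCk+nC[k+1]≡[n+1]C[k+1]; k>n⇒nCk≡0)
import Data.Nat.ListAction as ListAction
open import Data.Nat.Properties
open import Data.Nat.Solver using (module +-*-Solver)
open import Data.Product using (_×_; _,_; proj₁; proj₂; ∃; map₁)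
open import Data.Sum using (_⊎_; inj₁; inj₂; [_,_]′)
open import Data.Vec as Vec using (Vec; []; _∷_; lookup)
open import Data.Vec.Properties using (lookup-map; ∷-injective; tabulate∘lookup; tabulate-cong)
open import Function using (_∘_; id)
open import Relation.Binary.Definitions using (tri<; tri≈; tri>)
open import Relation.Binary.PropositionalEquality
open import Relation.Nullary using (Dec; yes; no; ¬_; contradiction)
open import Relation.Nullary.Decidable using (_×-dec_)
open import Relation.Unary using (Decidable)

-- Neither encoding is inverted explicitly; counting replaces the inverse. A step of a history
-- changes the height, so the histories are counted for every starting height h at once: there are
-- n! C(n, h) of them, which is n! at h = 0. Each encoding injects `perms n`, a list without
-- repetitions with at least n! entries, into a list of n! entries, so its image is that list up to
-- order, and filtering by totals gives equal lengths. The heights have different origins. For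
-- crossings, h at i counts the arcs with j < i ≤ σ(j), which are as many as those with j ≥ i >
-- σ(j). For patterns, h at v counts the descents with σ(r) ≥ v > σ(r+1). If b₁ = 0, the arc or
-- descent starting at v is itself among these h and contributes to neither x nor y; if b₁ = 1, all
-- h contribute. This is the origin of x + y + 1 = h + b₁.

private variable
  P Q R A A′ : Set

-- Indicators of decidable propositions

⟦_⟧ : Dec P → ℕ
⟦ yes _ ⟧ = 1
⟦ no _  ⟧ = 0

⟦⟧-true : (d : Dec P) → P → ⟦ d ⟧ ≡ 1
⟦⟧-true (yes _) p = refl
⟦⟧-true (no ¬p) p = contradiction p ¬p

⟦⟧-false : (d : Dec P) → ¬ P → ⟦ d ⟧ ≡ 0
⟦⟧-false (yes p) ¬p = contradiction p ¬p
⟦⟧-false (no _)  ¬p = refl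

⟦⟧-mono : (d : Dec P) (e : Dec Q) → (P → Q) → ⟦ d ⟧ ≤ ⟦ e ⟧
⟦⟧-mono (no _)  e f = z≤n
⟦⟧-mono (yes p) e f = ≤-reflexive (sym (⟦⟧-true e (f p)))

⟦⟧-cong : (d : Dec P) (e : Dec Q) → (P → Q) → (Q → P) → ⟦ d ⟧ ≡ ⟦ e ⟧
⟦⟧-cong d e f g = ≤-antisym (⟦⟧-mono d e f) (⟦⟧-mono e d g)

⟦⟧-reflects : (d : Dec P) (e : Dec Q) → ⟦ d ⟧ ≡ ⟦ e ⟧ → P → Q
⟦⟧-reflects d       (yes q) eq p = q
⟦⟧-reflects (yes _) (no _)  () p
⟦⟧-reflects (no ¬p) (no _)  eq p = contradiction p ¬p

⟦⟧-⊎ : (d : Dec P) (e : Dec Q) (f : Dec R) →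
       (P → Q ⊎ R) → (Q → P) → (R → P) → (Q → ¬ R) → ⟦ d ⟧ ≡ ⟦ e ⟧ + ⟦ f ⟧
⟦⟧-⊎ (yes p) e f split qp rp dis with split p
... | inj₁ q = sym (cong₂ _+_ (⟦⟧-true e q) (⟦⟧-false f (dis q)))
... | inj₂ r = sym (cong₂ _+_ (⟦⟧-false e λ q → dis q r) (⟦⟧-true f r))
⟦⟧-⊎ (no ¬p) e f split qp rp dis =
  sym (cong₂ _+_ (⟦⟧-false e (¬p ∘ qp)) (⟦⟧-false f (¬p ∘ rp)))

⟦⟧≤1 : ∀ {P} (d : Dec P) → ⟦ d ⟧ ≤ 1
⟦⟧≤1 (yes _) = ≤-refl
⟦⟧≤1 (no _)  = z≤n

⟦⟧-complement : ∀ {P Q : Set} (d : Dec P) (e : Dec Q) → (¬ P → Q) → (P → ¬ Q) → ⟦ d ⟧ + ⟦ e ⟧ ≡ 1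
⟦⟧-complement (yes p) e f g = cong suc (⟦⟧-false e (g p))
⟦⟧-complement (no ¬p) e f g = ⟦⟧-true e (f ¬p)

-- Finite sums over initial segments

sum : ℕ → (ℕ → ℕ) → ℕ
sum zero    f = 0
sum (suc n) f = sum n f + f n

sum-cong : ∀ n {f g} → (∀ {j} → j < n → f j ≡ g j) → sum n f ≡ sum n g
sum-cong zero    eq = refl
sum-cong (suc n) eq = cong₂ _+_ (sum-cong n (eq ∘ m<n⇒m<1+n)) (eq (n<1+n n))

sum-0 : ∀ n {f} → (∀ {j} → j < n → f j ≡ 0) → sum n f ≡ 0
sum-0 zero    eq = refl
sum-0 (suc n) eq = cong₂ _+_ (sum-0 n (eq ∘ m<n⇒m<1+n)) (eq (n<1+n n))

sum-+ : ∀ n {f g} → sum n (λ j → f j + g j) ≡ sum n f + sum n g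
sum-+ zero            = refl
sum-+ (suc n) {f} {g} = trans (cong (_+ (f n + g n)) (sum-+ n)) (interchange +-commutativeSemigroup (sum n f) (sum n g) (f n) (g n))

sum-≤ : ∀ n {f g} → (∀ {j} → j < n → f j ≤ g j) → sum n f ≤ sum n g
sum-≤ zero    le = z≤n
sum-≤ (suc n) le = +-mono-≤ (sum-≤ n (le ∘ m<n⇒m<1+n)) (le (n<1+n n))

sum-< : ∀ n {f g m} → (∀ {j} → j < n → f j ≤ g j) → m < n → f m < g m → sum n f < sum n g
sum-< (suc n) {m = m} le m<n lt with m ≟ n
... | yes refl = +-mono-≤-< (sum-≤ n (le ∘ m<n⇒m<1+n)) lt
... | no  m≢n  = +-mono-<-≤ (sum-< n (le ∘ m<n⇒m<1+n) (≤∧≢⇒< (s≤s⁻¹ m<n) m≢n) lt) (le (n<1+n n))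

sum-swap : ∀ m n {f : ℕ → ℕ → ℕ} →
           sum m (λ i → sum n (f i)) ≡ sum n (λ j → sum m (λ i → f i j))
sum-swap zero    n = sym (sum-0 n λ _ → refl)
sum-swap (suc m) n {f} = trans (cong (_+ sum n (f m)) (sum-swap m n)) (sym (sum-+ n))

sum-single : ∀ n {f m} → m < n → (∀ {j} → j < n → j ≢ m → f j ≡ 0) → sum n f ≡ f m
sum-single (suc n) {f} {m} m<n eq with m ≟ n
... | yes refl = cong (_+ f n) (sum-0 n λ j<n → eq (m<n⇒m<1+n j<n) (<⇒≢ j<n))
... | no  m≢n  = trans
  (cong₂ _+_ (sum-single n (≤∧≢⇒< (s≤s⁻¹ m<n) m≢n) (eq ∘ m<n⇒m<1+n)) (eq (n<1+n n) (≢-sym m≢n)))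
  (+-identityʳ (f m))

sum-1 : ∀ n → sum n (λ _ → 1) ≡ n
sum-1 zero    = refl
sum-1 (suc n) = trans (+-comm (sum n _) 1) (cong suc (sum-1 n))

sum-first : ∀ n f → sum (suc n) f ≡ f 0 + sum n (f ∘ suc)
sum-first zero    f = sym (+-identityʳ (f 0))
sum-first (suc n) f = trans (cong (_+ f (suc n)) (sum-first n f)) (+-assoc (f 0) _ _)

sum-truncate : ∀ {m} n {f} → m ≤ n → (∀ {j} → m ≤ j → j < n → f j ≡ 0) → sum n f ≡ sum m f
sum-truncate {m} n m≤n eq with m ≟ n
... | yes refl = refl
sum-truncate zero    z≤n eq | no 0≢0 = contradiction refl 0≢0
sum-truncate {m} (suc n) {f} m≤n eq | no m≢n = trans
  (cong₂ _+_ (sum-truncate n m≤n′ λ m≤j → eq m≤j ∘ m<n⇒m<1+n) (eq m≤n′ (n<1+n n)))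
  (+-identityʳ (sum m f))
  where m≤n′ = s≤s⁻¹ (≤∧≢⇒< m≤n m≢n)

sum-<? : ∀ {m} n → m ≤ n → sum n (λ j → ⟦ j <? m ⟧) ≡ m
sum-<? {m} n m≤n = trans (sum-truncate n m≤n λ m≤j _ → ⟦⟧-false (_ <? m) (≤⇒≯ m≤j))
  (trans (sum-cong m λ j<m → ⟦⟧-true (_ <? m) j<m) (sum-1 m))

sum-delta-below : ∀ q m (d : Dec P) → sum q (λ r → ⟦ (r ≟ m) ×-dec d ⟧) ≡ ⟦ m <? q ⟧ * ⟦ d ⟧
sum-delta-below q m d with m <? q
... | yes m<q = trans
  (sum-single q m<q λ {r} _ r≢m → ⟦⟧-false ((r ≟ m) ×-dec d) (r≢m ∘ proj₁))
  (trans (⟦⟧-cong ((m ≟ m) ×-dec d) d proj₂ (refl ,_)) (sym (*-identityˡ ⟦ d ⟧)))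
... | no  m≮q = sum-0 q λ {r} r<q → ⟦⟧-false ((r ≟ m) ×-dec d) λ { (refl , _) → m≮q r<q }

sum-delta : ∀ n {m} (d : Dec P) → m < n → sum n (λ j → ⟦ (j ≟ m) ×-dec d ⟧) ≡ ⟦ d ⟧
sum-delta n {m} d m<n = trans (sum-delta-below n m d)
  (trans (cong (_* ⟦ d ⟧) (⟦⟧-true (m <? n) m<n)) (*-identityˡ ⟦ d ⟧))

-- Eliminates an index i' = i + 1 from a sum over positions. Here m may equal n, where no such i'
-- exists; since `P n` fails, the term at this fictitious position is 0, as it should be.
sum-contract : ∀ {m} n {P : ℕ → Set} (d : ∀ j → Dec (P j)) → m ≤ n → ¬ P n →
               sum n (λ j → ⟦ (m ≟ j) ×-dec d j ⟧) ≡ ⟦ d m ⟧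
sum-contract {m} n d m≤n ¬pn with m≤n⇒m<n∨m≡n m≤n
... | inj₁ m<n  = trans
  (sum-single n m<n λ {j} _ j≢m → ⟦⟧-false ((m ≟ j) ×-dec d j) (j≢m ∘ sym ∘ proj₁))
  (⟦⟧-cong ((m ≟ m) ×-dec d m) (d m) proj₂ (refl ,_))
... | inj₂ refl = trans
  (sum-0 n λ {j} j<n → ⟦⟧-false ((n ≟ j) ×-dec d j) λ (n≡j , _) → <⇒≢ j<n (sym n≡j))
  (sym (⟦⟧-false (d n) ¬pn))

sum-⊎ : ∀ n {P Q R : ℕ → Set} (d : ∀ j → Dec (P j)) (e : ∀ j → Dec (Q j)) (f : ∀ j → Dec (R j)) →
        (∀ {j} → j < n → P j → Q j ⊎ R j) → (∀ {j} → j < n → Q j → P j) →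
        (∀ {j} → j < n → R j → P j) → (∀ {j} → Q j → ¬ R j) →
        sum n (λ j → ⟦ d j ⟧) ≡ sum n (λ j → ⟦ e j ⟧) + sum n (λ j → ⟦ f j ⟧)
sum-⊎ n d e f split qp rp dis = trans
  (sum-cong n λ {j} j<n → ⟦⟧-⊎ (d j) (e j) (f j) (split j<n) (qp j<n) (rp j<n) dis) (sum-+ n)

-- A permutation and its inverse as functions on ℕ, constrained only below n, so that comparisons
-- are plain arithmetic. The values from n on stay free, which leaves room for the sentinel
-- `s n = n` on the pattern side.
record IsBijection (n : ℕ) (s p : ℕ → ℕ) : Set where
  field
    s<n : ∀ {q} → q < n → s q < n
    p<n : ∀ {v} → v < n → p v < n
    s∘p : ∀ {v} → v < n → s (p v) ≡ v
    p∘s : ∀ {q} → q < n → p (s q) ≡ q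

  s-inj : ∀ {q r} → q < n → r < n → s q ≡ s r → q ≡ r
  s-inj q<n r<n eq = trans (sym (p∘s q<n)) (trans (cong p eq) (p∘s r<n))

  p-inj : ∀ {v u} → v < n → u < n → p v ≡ p u → v ≡ u
  p-inj v<n u<n eq = trans (sym (s∘p v<n)) (trans (cong s eq) (s∘p u<n))

  -- Double counting: f v is summed over the pairs (q, v) with v = s q, by positions or by values.
  sum-values : ∀ (f : ℕ → ℕ) → sum n (f ∘ s) ≡ sum n f
  sum-values f = begin
    sum n (f ∘ s)                                 ≡⟨ sum-cong n atPosition ⟨
    sum n (λ q → sum n (λ v → ⟦ v ≟ s q ⟧ * f v)) ≡⟨ sum-swap n n ⟩
    sum n (λ v → sum n (λ q → ⟦ v ≟ s q ⟧ * f v)) ≡⟨ sum-cong n atValue ⟩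
    sum n f                                       ∎
    where
    open ≡-Reasoning
    one : ∀ {v} (d : Dec P) → P → ⟦ d ⟧ * f v ≡ f v
    one {v = v} d x = trans (cong (_* f v) (⟦⟧-true d x)) (*-identityˡ (f v))
    atPosition : ∀ {q} → q < n → sum n (λ v → ⟦ v ≟ s q ⟧ * f v) ≡ f (s q)
    atPosition {q} q<n = trans
      (sum-single n (s<n q<n) λ {v} _ v≢sq → cong (_* f v) (⟦⟧-false (v ≟ s q) v≢sq))
      (one (s q ≟ s q) refl)
    atValue : ∀ {v} → v < n → sum n (λ q → ⟦ v ≟ s q ⟧ * f v) ≡ f v
    atValue {v} v<n = trans
      (sum-single n (p<n v<n) λ {q} q<n q≢pv → cong (_* f v)
        (⟦⟧-false (v ≟ s q) λ v≡sq → q≢pv (sym (trans (cong p v≡sq) (p∘s q<n)))))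
      (one (v ≟ s (p v)) (sym (s∘p v<n)))

  sum-positions : ∀ (f : ℕ → ℕ) → sum n (f ∘ p) ≡ sum n f
  sum-positions f = trans (sym (sum-values (f ∘ p))) (sum-cong n λ q<n → cong f (p∘s q<n))

-- Laguerre histories

record Code : Set where
  constructor code
  field
    b₁ b₂ x y : ℕ

open Code

length-cartesianProductWith : ∀ {A B C : Set} (f : A → B → C) xs ys →
                              length (cartesianProductWith f xs ys) ≡ length xs * length ys
length-cartesianProductWith f []       ys = refl
length-cartesianProductWith f (x ∷ xs) ys = trans (length-++ (map (f x) ys))
  (cong₂ _+_ (length-map (f x) ys) (length-cartesianProductWith f xs ys))

-- `splits 0` is empty, so at height 0 the steps with b₁ = 0 contribute nothing and the truncation
-- `pred 0 = 0` in `histories` creates no spurious path.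
splits : ℕ → List (ℕ × ℕ)
splits zero    = []
splits (suc h) = (0 , h) ∷ map (map₁ suc) (splits h)

length-splits : ∀ h → length (splits h) ≡ h
length-splits zero    = refl
length-splits (suc h) = cong suc (trans (length-map _ (splits h)) (length-splits h))

∈-splits : ∀ x {y h} → suc (x + y) ≡ h → (x , y) ∈ splits h
∈-splits zero    refl = here refl
∈-splits (suc x) refl = there (∈-map⁺ (map₁ suc) (∈-splits x refl))

prefixed : ℕ → ℕ → ℕ → List (List Code) → List (List Code)
prefixed b c k = cartesianProductWith (λ xy w → code b c (proj₁ xy) (proj₂ xy) ∷ w) (splits k)

length-prefixed : ∀ b c k ws → length (prefixed b c k ws) ≡ k * length ws
length-prefixed b c k ws = trans (length-cartesianProductWith _ (splits k) ws) (cong (_* length ws) (length-splits k))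

-- Codes of the histories with n steps from height h to height 0.
histories : ℕ → ℕ → List (List Code)
histories zero    zero    = [] ∷ []
histories zero    (suc h) = []
histories (suc n) h       =
  prefixed 1 1 (suc h) (histories n h) ++
  prefixed 1 0 (suc h) (histories n (suc h)) ++
  prefixed 0 0 h (histories n h) ++
  prefixed 0 1 h (histories n (pred h))

-- The height before letter v is a given function rather than a partial sum of the bits, so that
-- each encoding can supply its own combinatorial count for it.
record IsHistory (n : ℕ) (c : ℕ → Code) (h : ℕ → ℕ) : Set where
  field
    bit₁   : ∀ {v} → v < n → b₁ (c v) ≤ 1
    bit₂   : ∀ {v} → v < n → b₂ (c v) ≤ 1
    choice : ∀ {v} → v < n → suc (x (c v) + y (c v)) ≡ h v + b₁ (c v)
    step   : ∀ {v} → v < n → h (suc v) + b₂ (c v) ≡ h v + b₁ (c v)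
    end    : h n ≡ 0

∈-histories : ∀ n {c h} → IsHistory n c h → applyUpTo c n ∈ histories n (h 0)
∈-histories zero    {c} {h} hist rewrite IsHistory.end hist = here refl
∈-histories (suc n) {c₀} {h} hist =
  first (c₀ 0) (bit₁ z<s) (bit₂ z<s) (choice z<s) (step z<s)
  where
  open IsHistory hist
  rest : applyUpTo (c₀ ∘ suc) n ∈ histories n (h 1)
  rest = ∈-histories n record
    { bit₁ = bit₁ ∘ s<s ; bit₂ = bit₂ ∘ s<s ; choice = choice ∘ s<s ; step = step ∘ s<s ; end = end }
  prefix : ∀ {b c x y k l} → suc (x + y) ≡ k → h 1 ≡ l →
           code b c x y ∷ applyUpTo (c₀ ∘ suc) n ∈ prefixed b c k (histories n l)
  prefix {x = x} ch refl = ∈-cartesianProductWith⁺ _ (∈-splits x ch) rest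
  h₀ = h 0
  p₁₁ = prefixed 1 1 (suc h₀) (histories n h₀)
  p₁₀ = prefixed 1 0 (suc h₀) (histories n (suc h₀))
  p₀₀ = prefixed 0 0 h₀ (histories n h₀)
  first : ∀ d → b₁ d ≤ 1 → b₂ d ≤ 1 → suc (x d + y d) ≡ h 0 + b₁ d → h 1 + b₂ d ≡ h 0 + b₁ d →
          d ∷ applyUpTo (c₀ ∘ suc) n ∈ histories (suc n) (h 0)
  first (code 1 1 _ _) _ _ ch st = ∈-++⁺ˡ {xs = p₁₁}
    (prefix (trans ch (+-comm h₀ 1)) (+-cancelʳ-≡ 1 (h 1) h₀ st))
  first (code 1 0 _ _) _ _ ch st = ∈-++⁺ʳ p₁₁ (∈-++⁺ˡ {xs = p₁₀}
    (prefix (trans ch (+-comm h₀ 1)) (trans (sym (+-identityʳ (h 1))) (trans st (+-comm h₀ 1)))))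
  first (code 0 0 _ _) _ _ ch st = ∈-++⁺ʳ p₁₁ (∈-++⁺ʳ p₁₀ (∈-++⁺ˡ {xs = p₀₀}
    (prefix (trans ch (+-identityʳ h₀)) (+-cancelʳ-≡ 0 (h 1) h₀ st))))
  first (code 0 1 _ _) _ _ ch st = ∈-++⁺ʳ p₁₁ (∈-++⁺ʳ p₁₀ (∈-++⁺ʳ p₀₀
    (prefix (trans ch (+-identityʳ h₀)) (cong pred (trans (+-comm 1 (h 1)) (trans st (+-identityʳ h₀)))))))
  first (code (suc (suc _)) _ _ _) (s≤s ()) _ _ _
  first (code _ (suc (suc _)) _ _) _ (s≤s ()) _ _

-- This is (k+1) C(n, k+1) = (n - k) C(n, k) with the subtraction moved to the left. In the
-- induction on n, Pascal's rule reduces the claim to the instances k and k + 1 of the previous row.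
absorption : ∀ n k → suc k * (n C suc k) + k * (n C k) ≡ n * (n C k)
absorption zero    zero    = refl
absorption zero    (suc k) rewrite k>n⇒nCk≡0 {0} {suc (suc k)} z<s | k>n⇒nCk≡0 {0} {suc k} z<s
                                 | *-zeroʳ k = refl
absorption (suc n) zero    = trans (+-identityʳ _) (trans (*-identityˡ _) (begin
  suc n C 1                         ≡⟨ nCk+nC[k+1]≡[n+1]C[k+1] n 0 ⟨
  n C 0 + n C 1                     ≡⟨ cong₂ _+_ refl (trans (sym (*-identityˡ (n C 1))) (sym (+-identityʳ _))) ⟩
  1 + (1 * (n C 1) + 0 * (n C 0))   ≡⟨ cong suc (absorption n 0) ⟩
  1 + n * 1                         ∎))
  where open ≡-Reasoning
absorption (suc n) (suc k) = begin
  suc (suc k) * (suc n C suc (suc k)) + suc k * (suc n C suc k)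
    ≡⟨ cong₂ (λ a b → suc (suc k) * a + suc k * b) (pascal (suc k)) (pascal k) ⟨
  suc (suc k) * (c₁ + c₂) + suc k * (c₀ + c₁)
    ≡⟨ solve 4 (λ k z b a → (con 2 :+ k) :* (b :+ a) :+ (con 1 :+ k) :* (z :+ b)
        := ((con 2 :+ k) :* a :+ (con 1 :+ k) :* b) :+ b :+ (((con 1 :+ k) :* b :+ k :* z) :+ z)) refl k c₀ c₁ c₂ ⟩
  (suc (suc k) * c₂ + suc k * c₁) + c₁ + ((suc k * c₁ + k * c₀) + c₀)
    ≡⟨ cong₂ (λ u v → u + c₁ + (v + c₀)) (absorption n (suc k)) (absorption n k) ⟩
  n * c₁ + c₁ + (n * c₀ + c₀)
    ≡⟨ solve 3 (λ n b z → n :* b :+ b :+ (n :* z :+ z) := (con 1 :+ n) :* (z :+ b)) refl n c₁ c₀ ⟩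
  suc n * (c₀ + c₁)
    ≡⟨ cong (suc n *_) (pascal k) ⟩
  suc n * (suc n C suc k) ∎
  where
  open ≡-Reasoning
  open +-*-Solver
  pascal = nCk+nC[k+1]≡[n+1]C[k+1] n
  c₀ = n C k
  c₁ = n C suc k
  c₂ = n C suc (suc k)

-- The four kinds of step give L(n+1, h) = (h+1) L(n, h) + (h+1) L(n, h+1) + h L(n, h) + h L(n,
-- h-1). With L(n, h) = n! C(n, h), Pascal's rule leaves n! times (h+1) C(n+1, h+1) + h C(n+1, h),
-- which is (n+1) C(n+1, h) by absorption.
length-histories : ∀ n h → length (histories n h) ≡ n ! * (n C h)
length-histories zero    zero    = refl
length-histories zero    (suc h) rewrite k>n⇒nCk≡0 {0} {suc h} z<s = refl
length-histories (suc n) h       = begin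
  length (p₁₁ ++ p₁₀ ++ p₀₀ ++ p₀₁)
    ≡⟨ trans (length-++ p₁₁) (cong (length p₁₁ +_) (trans (length-++ p₁₀) (cong (length p₁₀ +_) (length-++ p₀₀)))) ⟩
  length p₁₁ + (length p₁₀ + (length p₀₀ + length p₀₁))
    ≡⟨ cong₂ _+_ (part 1 1 (suc h) h) (cong₂ _+_ (part 1 0 (suc h) (suc h)) (cong₂ _+_ (part 0 0 h h) (part 0 1 h (pred h)))) ⟩
  suc h * (n ! * (n C h)) + (suc h * (n ! * (n C suc h)) + (h * (n ! * (n C h)) + h * (n ! * (n C pred h))))
    ≡⟨ collect h ⟩
  suc n ! * (suc n C h) ∎
  where
  open ≡-Reasoning
  open +-*-Solver
  p₁₁ = prefixed 1 1 (suc h) (histories n h)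
  p₁₀ = prefixed 1 0 (suc h) (histories n (suc h))
  p₀₀ = prefixed 0 0 h (histories n h)
  p₀₁ = prefixed 0 1 h (histories n (pred h))
  part : ∀ b c k l → length (prefixed b c k (histories n l)) ≡ k * (n ! * (n C l))
  part b c k l = trans (length-prefixed b c k (histories n l)) (cong (k *_) (length-histories n l))
  collect : ∀ h → suc h * (n ! * (n C h)) + (suc h * (n ! * (n C suc h)) + (h * (n ! * (n C h)) + h * (n ! * (n C pred h))))
            ≡ suc n ! * (suc n C h)
  collect zero = begin
    1 * (n ! * 1) + (1 * (n ! * (n C 1)) + 0)
      ≡⟨ solve 2 (λ f a → con 1 :* (f :* con 1) :+ (con 1 :* (f :* a) :+ con 0) := f :* (con 1 :+ (con 1 :* a :+ con 0))) refl (n !) (n C 1) ⟩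
    n ! * (1 + (1 * (n C 1) + 0))
      ≡⟨ cong (λ u → n ! * (1 + u)) (absorption n 0) ⟩
    n ! * (1 + n * 1)
      ≡⟨ solve 2 (λ f n → f :* (con 1 :+ n :* con 1) := (f :+ n :* f) :* con 1) refl (n !) n ⟩
    suc n ! * 1 ∎
  collect (suc k) = begin
    suc (suc k) * (n ! * c₁) + (suc (suc k) * (n ! * c₂) + (suc k * (n ! * c₁) + suc k * (n ! * c₀)))
      ≡⟨ solve 5 (λ k f z b a → (con 2 :+ k) :* (f :* b) :+ ((con 2 :+ k) :* (f :* a) :+ ((con 1 :+ k) :* (f :* b) :+ (con 1 :+ k) :* (f :* z)))
          := f :* ((con 2 :+ k) :* (b :+ a) :+ (con 1 :+ k) :* (z :+ b))) refl k (n !) c₀ c₁ c₂ ⟩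
    n ! * (suc (suc k) * (c₁ + c₂) + suc k * (c₀ + c₁))
      ≡⟨ cong₂ (λ a b → n ! * (suc (suc k) * a + suc k * b)) (pascal (suc k)) (pascal k) ⟩
    n ! * (suc (suc k) * (suc n C suc (suc k)) + suc k * (suc n C suc k))
      ≡⟨ cong (n ! *_) (absorption (suc n) (suc k)) ⟩
    n ! * (suc n * (suc n C suc k))
      ≡⟨ trans (sym (*-assoc (n !) (suc n) _)) (cong (_* (suc n C suc k)) (*-comm (n !) (suc n))) ⟩
    suc n ! * (suc n C suc k) ∎
    where
    pascal = nCk+nC[k+1]≡[n+1]C[k+1] n
    c₀ = n C k
    c₁ = n C suc k
    c₂ = n C suc (suc k)

-- Images of injections between finite lists

module _ {A B : Set} (f : A → B) where

  -- Pigeonhole principle with remainder: the image of the head is removed from `ys`, and the later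
  -- images survive because injectivity and uniqueness make them different from it. The remainder
  -- `zs` is empty when `ys` is no longer than `xs`.
  ↭-split-image : ∀ {xs ys} → Unique xs →
                  (∀ {x x′} → x ∈ xs → x′ ∈ xs → f x ≡ f x′ → x ≡ x′) →
                  (∀ {x} → x ∈ xs → f x ∈ ys) → ∃ λ zs → ys ↭ map f xs ++ zs
  ↭-split-image {[]}     {ys} _ _ _ = ys , ↭-refl
  ↭-split-image {x ∷ xs} {ys} (x∉xs ∷ uniq) inj mem with ∈-∃++ (mem (here refl))
  ... | as , bs , refl = zs , ↭-trans (shift (f x) as bs) (prep (f x) ys↭)
    where
    rest = ↭-split-image {xs} {as ++ bs} uniq (λ i j → inj (there i) (there j)) λ {x′} i →
      drop (mem (there i)) λ eq → All.lookup x∉xs i (inj (here refl) (there i) (sym eq))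
      where
      drop : ∀ {z} → z ∈ as ++ f x ∷ bs → z ≢ f x → z ∈ as ++ bs
      drop i z≢ with ∈-resp-↭ (shift (f x) as bs) i
      ... | here  eq = contradiction eq z≢
      ... | there i′ = i′
    zs  = proj₁ rest
    ys↭ = proj₂ rest

  length-image : ∀ {xs ys} → Unique xs →
                 (∀ {x x′} → x ∈ xs → x′ ∈ xs → f x ≡ f x′ → x ≡ x′) →
                 (∀ {x} → x ∈ xs → f x ∈ ys) → length xs ≤ length ys
  length-image {xs} uniq inj mem with ↭-split-image uniq inj mem
  ... | zs , ys↭ = ≤-trans (m≤m+n (length xs) (length zs)) (≤-reflexive (sym
    (trans (↭-length ys↭) (trans (length-++ (map f xs)) (cong (_+ length zs) (length-map f xs))))))

  image-↭ : ∀ {xs ys} → Unique xs →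
            (∀ {x x′} → x ∈ xs → x′ ∈ xs → f x ≡ f x′ → x ≡ x′) →
            (∀ {x} → x ∈ xs → f x ∈ ys) → length ys ≤ length xs → ys ↭ map f xs
  image-↭ {xs} uniq inj mem le with ↭-split-image uniq inj mem
  ... | []     , ys↭ = ↭-trans ys↭ (++-identityʳ _)
  ... | z ∷ zs , ys↭ = contradiction (≤-trans (≤-reflexive (sym (trans (↭-length ys↭)
    (trans (length-++ (map f xs)) (cong (_+ suc (length zs)) (length-map f xs)))))) le) (m+1+n≰m (length xs))

-- Permutations in one-line notation and their number

concatMap-map : ∀ {A B C : Set} (f : A → B → C) xs ys → concatMap (λ a → map (f a) ys) xs ≡ cartesianProductWith f xs ys
concatMap-map f []       ys = refl
concatMap-map f (x ∷ xs) ys = cong (map (f x) ys ++_) (concatMap-map f xs ys)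

words-unique : ∀ m n → Unique (words m n)
words-unique m zero    = All.[] ∷ AllPairs.[]
words-unique m (suc n) = subst Unique (sym (concatMap-map _∷_ (allFin m) (words m n)))
  (Unique.cartesianProductWith⁺ _∷_ ∷-injective (allFin⁺ m) (words-unique m n))

words-complete : ∀ {m n} (w : Vec (Fin m) n) → w ∈ words m n
words-complete []      = here refl
words-complete {m} {suc n} (a ∷ w) = subst ((a ∷ w) ∈_) (sym (concatMap-map _∷_ (allFin m) (words m n)))
  (∈-cartesianProductWith⁺ _∷_ (∈-allFin a) (words-complete w))

perms-unique : ∀ n → Unique (perms n)
perms-unique n = filter⁺ isPerm? (words-unique n n)

∈-perms : ∀ {n} {w : Vec (Fin n) n} → IsPerm w → w ∈ perms n
∈-perms = ∈-filter⁺ isPerm? (words-complete _)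

perms-sound : ∀ {n} {w : Vec (Fin n) n} → w ∈ perms n → IsPerm w
perms-sound {n} = proj₂ ∘ ∈-filter⁻ isPerm? {xs = words n n}

-- The first letter is arbitrary, and `punchIn a` relabels the others by the values different from
-- a; iterating this produces n! distinct permutations.
insert : ∀ {n} → Fin (suc n) → Vec (Fin n) n → Vec (Fin (suc n)) (suc n)
insert a w = a ∷ Vec.map (punchIn a) w

map-punchIn-injective : ∀ {m n} (a : Fin (suc n)) (u w : Vec (Fin n) m) → Vec.map (punchIn a) u ≡ Vec.map (punchIn a) w → u ≡ w
map-punchIn-injective a []      []      eq = refl
map-punchIn-injective a (b ∷ u) (c ∷ w) eq with ∷-injective eq
... | b≡c , u≡w = cong₂ _∷_ (punchIn-injective a b c b≡c) (map-punchIn-injective a u w u≡w)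

insert-injective : ∀ {n} {a b : Fin (suc n)} {u w : Vec (Fin n) n} → insert a u ≡ insert b w → a ≡ b × u ≡ w
insert-injective {a = a} {u = u} {w} eq with ∷-injective eq
... | refl , eq′ = refl , map-punchIn-injective a u w eq′

insert-IsPerm : ∀ {n} (a : Fin (suc n)) (w : Vec (Fin n) n) → IsPerm w → IsPerm (insert a w)
insert-IsPerm a w perm zero    zero    eq = refl
insert-IsPerm a w perm zero    (suc j) eq = contradiction (trans (sym (lookup-map j (punchIn a) w)) (sym eq)) (punchInᵢ≢i a _)
insert-IsPerm a w perm (suc i) zero    eq = contradiction (trans (sym (lookup-map i (punchIn a) w)) eq) (punchInᵢ≢i a _)
insert-IsPerm a w perm (suc i) (suc j) eq = cong suc (perm i j (punchIn-injective a _ _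
  (trans (sym (lookup-map i (punchIn a) w)) (trans eq (lookup-map j (punchIn a) w)))))

insertions : ∀ n → List (Vec (Fin n) n)
insertions zero    = [] ∷ []
insertions (suc n) = cartesianProductWith insert (allFin (suc n)) (insertions n)

insertions-unique : ∀ n → Unique (insertions n)
insertions-unique zero    = All.[] ∷ AllPairs.[]
insertions-unique (suc n) = Unique.cartesianProductWith⁺ insert insert-injective (allFin⁺ (suc n)) (insertions-unique n)

insertions-perm : ∀ n {w} → w ∈ insertions n → IsPerm w
insertions-perm zero    _ ()
insertions-perm (suc n) w∈ with ∈-cartesianProductWith⁻ insert (allFin (suc n)) (insertions n) w∈
... | a , u , _ , u∈ , refl = insert-IsPerm a u (insertions-perm n u∈)

length-insertions : ∀ n → length (insertions n) ≡ n !
length-insertions zero    = refl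
length-insertions (suc n) = trans (length-cartesianProductWith insert (allFin (suc n)) (insertions n))
  (cong₂ _*_ (length-tabulate {n = suc n} id) (length-insertions n))

n!≤length-perms : ∀ n → n ! ≤ length (perms n)
n!≤length-perms n = ≤-trans (≤-reflexive (sym (length-insertions n)))
  (length-image id (insertions-unique n) (λ _ _ eq → eq) (∈-perms ∘ insertions-perm n))

histories↭codes : ∀ n (f : Vec (Fin n) n → List Code) →
  (∀ {u w} → IsPerm u → IsPerm w → f u ≡ f w → u ≡ w) →
  (∀ {w} → IsPerm w → f w ∈ histories n 0) → histories n 0 ↭ map f (perms n)
histories↭codes n f inj mem = image-↭ f (perms-unique n)
  (λ i j → inj (perms-sound i) (perms-sound j)) (mem ∘ perms-sound)
  (≤-trans (≤-reflexive (trans (length-histories n 0) (*-identityʳ (n !)))) (n!≤length-perms n))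

-- Crossings and nestings

rank-decreasing : ∀ n {P : ℕ → Set} (d : ∀ b → Dec (P b)) {a a′} → a < a′ → a′ < n → P a′ →
                  sum n (λ b → ⟦ d b ×-dec (a′ <? b) ⟧) < sum n (λ b → ⟦ d b ×-dec (a <? b) ⟧)
rank-decreasing n d {a} {a′} lt a′<n pa′ = sum-< n
  (λ {b} _ → ⟦⟧-mono (d b ×-dec (a′ <? b)) (d b ×-dec (a <? b)) λ (pb , l) → pb , <-trans lt l) a′<n
  (subst₂ _<_ (sym (⟦⟧-false (d a′ ×-dec (a′ <? a′)) (<-irrefl refl ∘ proj₂)))
              (sym (⟦⟧-true (d a′ ×-dec (a <? a′)) (pa′ , lt))) z<s)

-- The number of larger elements of P drops strictly as the element grows, so it identifies the
-- element. This is the decoding step for crossing codes.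
rank-injective : ∀ n {P : ℕ → Set} (d : ∀ b → Dec (P b)) {a a′} → a < n → a′ < n → P a → P a′ →
                 sum n (λ b → ⟦ d b ×-dec (a <? b) ⟧) ≡ sum n (λ b → ⟦ d b ×-dec (a′ <? b) ⟧) → a ≡ a′
rank-injective n {P} d {a} {a′} a<n a′<n pa pa′ eq with <-cmp a a′
... | tri< lt _ _ = contradiction (sym eq) (<⇒≢ (rank-decreasing n d lt a′<n pa′))
... | tri≈ _ a≡a′ _ = a≡a′
... | tri> _ _ gt = contradiction eq (<⇒≢ (rank-decreasing n d gt a<n pa))

module _ (s : ℕ → ℕ) where
  cross⁺? : ∀ i j → Dec (j < i × i ≤ s j × s j < s i)
  cross⁺? i j = (j <? i) ×-dec (i ≤? s j) ×-dec (s j <? s i)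

  cross⁻? : ∀ i j → Dec (i < j × s j < i × s i < s j)
  cross⁻? i j = (i <? j) ×-dec (s j <? i) ×-dec (s i <? s j)

  nest⁺? : ∀ i j → Dec (j < i × i ≤ s i × s i < s j)
  nest⁺? i j = (j <? i) ×-dec (i ≤? s i) ×-dec (s i <? s j)

  nest⁻? : ∀ i j → Dec (i < j × s i < i × s j < s i)
  nest⁻? i j = (i <? j) ×-dec (s i <? i) ×-dec (s j <? s i)

crossingCode : ℕ → (s p : ℕ → ℕ) → ℕ → Code
crossingCode n s p i = code ⟦ i ≤? s i ⟧ ⟦ p i ≤? i ⟧
  (sum n (λ j → ⟦ cross⁺? s i j ⟧) + sum n (λ j → ⟦ cross⁻? s i j ⟧))
  (sum n (λ j → ⟦ nest⁺? s i j ⟧) + sum n (λ j → ⟦ nest⁻? s i j ⟧))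

module CrossingHistory {n s p} (bij : IsBijection n s p) where
  open IsBijection bij

  open-arcs : ℕ → ℕ
  open-arcs i = sum n λ j → ⟦ (j <? i) ×-dec (i ≤? s j) ⟧

  -- Both sides count the j with j ≤ i ≤ s j: the arcs reaching beyond i plus the one ending at i,
  -- or the arcs begun before i plus the one beginning at i.
  open-arcs-suc : ∀ {i} → i < n → open-arcs (suc i) + ⟦ p i ≤? i ⟧ ≡ open-arcs i + ⟦ i ≤? s i ⟧
  open-arcs-suc {i} i<n = begin
    open-arcs (suc i) + ⟦ p i ≤? i ⟧
      ≡⟨ cong (open-arcs (suc i) +_) (sum-delta n (p i ≤? i) (p<n i<n)) ⟨
    open-arcs (suc i) + sum n (λ j → ⟦ (j ≟ p i) ×-dec (p i ≤? i) ⟧)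
      ≡⟨ sum-⊎ n (λ j → (j ≤? i) ×-dec (i ≤? s j)) (λ j → (j <? suc i) ×-dec (suc i ≤? s j))
           (λ j → (j ≟ p i) ×-dec (p i ≤? i))
           closes (λ _ (j≤i , i<sj) → s≤s⁻¹ j≤i , <⇒≤ i<sj)
           (λ { _ (refl , pi≤i) → pi≤i , ≤-reflexive (sym (s∘p i<n)) })
           (λ { (_ , i<sj) (refl , _) → <-irrefl (sym (s∘p i<n)) i<sj }) ⟨
    sum n (λ j → ⟦ (j ≤? i) ×-dec (i ≤? s j) ⟧)
      ≡⟨ sum-⊎ n (λ j → (j ≤? i) ×-dec (i ≤? s j)) (λ j → (j <? i) ×-dec (i ≤? s j))
           (λ j → (j ≟ i) ×-dec (i ≤? s i))
           opens (λ _ (j<i , i≤sj) → <⇒≤ j<i , i≤sj)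
           (λ { _ (refl , i≤si) → ≤-refl , i≤si }) (λ { (i<i , _) (refl , _) → <-irrefl refl i<i }) ⟩
    open-arcs i + sum n (λ j → ⟦ (j ≟ i) ×-dec (i ≤? s i) ⟧)
      ≡⟨ cong (open-arcs i +_) (sum-delta n (i ≤? s i) i<n) ⟩
    open-arcs i + ⟦ i ≤? s i ⟧ ∎
    where
    open ≡-Reasoning
    closes : ∀ {j} → j < n → j ≤ i × i ≤ s j → (j < suc i × suc i ≤ s j) ⊎ (j ≡ p i × p i ≤ i)
    closes {j} j<n (j≤i , i≤sj) with i ≟ s j
    ... | yes refl = inj₂ (sym (p∘s j<n) , subst (_≤ i) (sym (p∘s j<n)) j≤i)
    ... | no  i≢sj = inj₁ (s≤s j≤i , ≤∧≢⇒< i≤sj i≢sj)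
    opens : ∀ {j} → j < n → j ≤ i × i ≤ s j → (j < i × i ≤ s j) ⊎ (j ≡ i × i ≤ s i)
    opens {j} j<n (j≤i , i≤sj) with j ≟ i
    ... | yes refl = inj₂ (refl , i≤sj)
    ... | no  j≢i  = inj₁ (≤∧≢⇒< j≤i j≢i , i≤sj)

  -- As many positions as values lie below i; cancelling the j with both j and s j below i leaves
  -- the arcs over the gap in the two directions.
  open-arcs-balance : ∀ {i} → i ≤ n → sum n (λ j → ⟦ (i ≤? j) ×-dec (s j <? i) ⟧) ≡ open-arcs i
  open-arcs-balance {i} i≤n = +-cancelˡ-≡ both _ _ (begin
    both + sum n (λ j → ⟦ (i ≤? j) ×-dec (s j <? i) ⟧)
      ≡⟨ sum-⊎ n (λ j → s j <? i) (λ j → (j <? i) ×-dec (s j <? i)) (λ j → (i ≤? j) ×-dec (s j <? i))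
           byPosition (λ _ → proj₂) (λ _ → proj₂) (λ (j<i , _) (i≤j , _) → <⇒≱ j<i i≤j) ⟨
    sum n (λ j → ⟦ s j <? i ⟧)
      ≡⟨ sum-values (λ v → ⟦ v <? i ⟧) ⟩
    sum n (λ j → ⟦ j <? i ⟧)
      ≡⟨ sum-⊎ n (λ j → j <? i) (λ j → (j <? i) ×-dec (s j <? i)) (λ j → (j <? i) ×-dec (i ≤? s j))
           byValue (λ _ → proj₁) (λ _ → proj₁) (λ (_ , sj<i) (_ , i≤sj) → <⇒≱ sj<i i≤sj) ⟩
    both + open-arcs i ∎)
    where
    open ≡-Reasoning
    both = sum n (λ j → ⟦ (j <? i) ×-dec (s j <? i) ⟧)
    byPosition : ∀ {j} → j < n → s j < i → (j < i × s j < i) ⊎ (i ≤ j × s j < i)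
    byPosition {j} _ sj<i with j <? i
    ... | yes j<i = inj₁ (j<i , sj<i)
    ... | no  j≮i = inj₂ (≮⇒≥ j≮i , sj<i)
    byValue : ∀ {j} → j < n → j < i → (j < i × s j < i) ⊎ (j < i × i ≤ s j)
    byValue {j} _ j<i with s j <? i
    ... | yes sj<i = inj₁ (j<i , sj<i)
    ... | no  sj≮i = inj₂ (j<i , ≮⇒≥ sj≮i)

  -- Only C₊(i) and A₊(i) can be nonempty, and each open arc lies in one of them according as s j is
  -- below or above s i.
  exceedance-choices : ∀ {i} → i < n → i ≤ s i →
    suc (x (crossingCode n s p i) + y (crossingCode n s p i)) ≡ open-arcs i + ⟦ i ≤? s i ⟧
  exceedance-choices {i} i<n i≤si = begin
    suc ((C⁺ + C⁻) + (N⁺ + N⁻))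
      ≡⟨ cong₂ (λ a b → suc ((C⁺ + a) + (N⁺ + b)))
           (sum-0 n λ {j} _ → ⟦⟧-false (cross⁻? s i j) λ (_ , sj<i , si<sj) → <⇒≱ (<-trans si<sj sj<i) i≤si)
           (sum-0 n λ {j} _ → ⟦⟧-false (nest⁻? s i j) λ (_ , si<i , _) → <⇒≱ si<i i≤si) ⟩
    suc ((C⁺ + 0) + (N⁺ + 0))
      ≡⟨ cong suc (cong₂ _+_ (+-identityʳ C⁺) (+-identityʳ N⁺)) ⟩
    suc (C⁺ + N⁺)
      ≡⟨ cong suc (sum-⊎ n (λ j → (j <? i) ×-dec (i ≤? s j)) (cross⁺? s i) (nest⁺? s i)
           trichotomy (λ _ (j<i , i≤sj , _) → j<i , i≤sj) (λ _ (j<i , i≤si , si<sj) → j<i , ≤-trans i≤si (<⇒≤ si<sj))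
           (λ (_ , _ , sj<si) (_ , _ , si<sj) → <-asym sj<si si<sj)) ⟨
    suc (open-arcs i)
      ≡⟨ +-comm 1 (open-arcs i) ⟩
    open-arcs i + 1
      ≡⟨ cong (open-arcs i +_) (⟦⟧-true (i ≤? s i) i≤si) ⟨
    open-arcs i + ⟦ i ≤? s i ⟧ ∎
    where
    open ≡-Reasoning
    C⁺ = sum n (λ j → ⟦ cross⁺? s i j ⟧)
    C⁻ = sum n (λ j → ⟦ cross⁻? s i j ⟧)
    N⁺ = sum n (λ j → ⟦ nest⁺? s i j ⟧)
    N⁻ = sum n (λ j → ⟦ nest⁻? s i j ⟧)
    trichotomy : ∀ {j} → j < n → j < i × i ≤ s j → (j < i × i ≤ s j × s j < s i) ⊎ (j < i × i ≤ s i × s i < s j)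
    trichotomy {j} j<n (j<i , i≤sj) with <-cmp (s j) (s i)
    ... | tri< lt _ _ = inj₁ (j<i , i≤sj , lt)
    ... | tri≈ _ eq _ = contradiction (s-inj j<n i<n eq) (<⇒≢ j<i)
    ... | tri> _ _ gt = inj₂ (j<i , i≤si , gt)

  -- The arcs from j ≥ i back to s j < i are as many as the open arcs. The arc of i is one of them
  -- and accounts for the extra 1; every other one crosses or nests with it.
  deficiency-choices : ∀ {i} → i < n → s i < i →
    suc (x (crossingCode n s p i) + y (crossingCode n s p i)) ≡ open-arcs i + ⟦ i ≤? s i ⟧
  deficiency-choices {i} i<n si<i = begin
    suc ((C⁺ + C⁻) + (N⁺ + N⁻))
      ≡⟨ cong₂ (λ a b → suc ((a + C⁻) + (b + N⁻)))
           (sum-0 n λ {j} _ → ⟦⟧-false (cross⁺? s i j) λ (_ , i≤sj , sj<si) → <⇒≱ (<-trans sj<si si<i) i≤sj)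
           (sum-0 n λ {j} _ → ⟦⟧-false (nest⁺? s i j) λ (_ , i≤si , _) → <⇒≱ si<i i≤si) ⟩
    suc (C⁻ + N⁻)
      ≡⟨ +-comm 1 (C⁻ + N⁻) ⟩
    (C⁻ + N⁻) + 1
      ≡⟨ cong₂ _+_
           (sum-⊎ n (λ j → (i <? j) ×-dec (s j <? i)) (cross⁻? s i) (nest⁻? s i)
             trichotomy (λ _ (i<j , sj<i , _) → i<j , sj<i) (λ _ (i<j , si<i , sj<si) → i<j , <-trans sj<si si<i)
             (λ (_ , _ , si<sj) (_ , _ , sj<si) → <-asym sj<si si<sj))
           (trans (sum-delta n (s i <? i) i<n) (⟦⟧-true (s i <? i) si<i)) ⟨
    sum n (λ j → ⟦ (i <? j) ×-dec (s j <? i) ⟧) + sum n (λ j → ⟦ (j ≟ i) ×-dec (s i <? i) ⟧)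
      ≡⟨ sum-⊎ n (λ j → (i ≤? j) ×-dec (s j <? i)) (λ j → (i <? j) ×-dec (s j <? i)) (λ j → (j ≟ i) ×-dec (s i <? i))
           strict (λ _ (i<j , sj<i) → <⇒≤ i<j , sj<i) (λ { _ (refl , si<i) → ≤-refl , si<i })
           (λ { (i<i , _) (refl , _) → <-irrefl refl i<i }) ⟨
    sum n (λ j → ⟦ (i ≤? j) ×-dec (s j <? i) ⟧)
      ≡⟨ open-arcs-balance (<⇒≤ i<n) ⟩
    open-arcs i
      ≡⟨ +-identityʳ (open-arcs i) ⟨
    open-arcs i + 0
      ≡⟨ cong (open-arcs i +_) (⟦⟧-false (i ≤? s i) (<⇒≱ si<i)) ⟨
    open-arcs i + ⟦ i ≤? s i ⟧ ∎
    where
    open ≡-Reasoning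
    C⁺ = sum n (λ j → ⟦ cross⁺? s i j ⟧)
    C⁻ = sum n (λ j → ⟦ cross⁻? s i j ⟧)
    N⁺ = sum n (λ j → ⟦ nest⁺? s i j ⟧)
    N⁻ = sum n (λ j → ⟦ nest⁻? s i j ⟧)
    trichotomy : ∀ {j} → j < n → i < j × s j < i → (i < j × s j < i × s i < s j) ⊎ (i < j × s i < i × s j < s i)
    trichotomy {j} j<n (i<j , sj<i) with <-cmp (s i) (s j)
    ... | tri< lt _ _ = inj₁ (i<j , sj<i , lt)
    ... | tri≈ _ eq _ = contradiction (s-inj i<n j<n eq) (<⇒≢ i<j)
    ... | tri> _ _ gt = inj₂ (i<j , si<i , gt)
    strict : ∀ {j} → j < n → i ≤ j × s j < i → (i < j × s j < i) ⊎ (j ≡ i × s i < i)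
    strict {j} _ (i≤j , sj<i) with j ≟ i
    ... | yes refl = inj₂ (refl , sj<i)
    ... | no  j≢i  = inj₁ (≤∧≢⇒< i≤j (≢-sym j≢i) , sj<i)

  isHistory : IsHistory n (crossingCode n s p) open-arcs
  isHistory = record
    { bit₁   = λ {i} _ → ⟦⟧≤1 (i ≤? s i)
    ; bit₂   = λ {i} _ → ⟦⟧≤1 (p i ≤? i)
    ; choice = λ {i} i<n → [ exceedance-choices i<n , deficiency-choices i<n ]′ (≤-<-connex i (s i))
    ; step   = open-arcs-suc
    ; end    = sum-0 n λ {j} j<n → ⟦⟧-false ((j <? n) ×-dec (n ≤? s j)) λ (_ , n≤sj) → <⇒≱ (s<n j<n) n≤sj
    }

  open-arcs-0 : open-arcs 0 ≡ 0
  open-arcs-0 = sum-0 n λ {j} _ → ⟦⟧-false ((j <? 0) ×-dec (0 ≤? s j)) λ ()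

  -- The crossings (nestings) of a deficiency (weak exceedance) i count the larger values among those
  -- still available for position i.
  deficiency-x : ∀ {i} → i < n → s i < i → x (crossingCode n s p i) ≡
                 sum n (λ b → ⟦ ((b <? i) ×-dec (i ≤? p b)) ×-dec (s i <? b) ⟧)
  deficiency-x {i} i<n si<i = cong₂ _+_
    (sum-0 n λ {j} _ → ⟦⟧-false (cross⁺? s i j) λ (_ , i≤sj , sj<si) → <⇒≱ (<-trans sj<si si<i) i≤sj)
    (trans (sym (sum-positions _)) (sum-cong n λ {b} b<n →
      ⟦⟧-cong (cross⁻? s i (p b)) (((b <? i) ×-dec (i ≤? p b)) ×-dec (s i <? b))
        (λ (i<pb , spb<i , si<spb) → (subst (_< i) (s∘p b<n) spb<i , <⇒≤ i<pb) , subst (s i <_) (s∘p b<n) si<spb)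
        (λ ((b<i , i≤pb) , si<b) →
          ≤∧≢⇒< i≤pb (λ eq → <⇒≢ si<b (trans (cong s eq) (s∘p b<n))) ,
          subst (_< i) (sym (s∘p b<n)) b<i , subst (s i <_) (sym (s∘p b<n)) si<b)))

  exceedance-y : ∀ {i} → i < n → i ≤ s i → y (crossingCode n s p i) ≡
                 sum n (λ b → ⟦ ((i ≤? b) ×-dec (p b ≤? i)) ×-dec (s i <? b) ⟧)
  exceedance-y {i} i<n i≤si = trans (cong₂ _+_
    (trans (sym (sum-positions _)) (sum-cong n λ {b} b<n →
      ⟦⟧-cong (nest⁺? s i (p b)) (((i ≤? b) ×-dec (p b ≤? i)) ×-dec (s i <? b))
        (λ (pb<i , _ , si<spb) → let si<b = subst (s i <_) (s∘p b<n) si<spb in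
          (≤-trans i≤si (<⇒≤ si<b) , <⇒≤ pb<i) , si<b)
        (λ ((_ , pb≤i) , si<b) →
          ≤∧≢⇒< pb≤i (λ eq → <⇒≢ si<b (trans (cong s (sym eq)) (s∘p b<n))) , i≤si ,
          subst (s i <_) (sym (s∘p b<n)) si<b)))
    (sum-0 n λ {j} _ → ⟦⟧-false (nest⁻? s i j) λ (_ , si<i , _) → <⇒≱ si<i i≤si))
    (+-identityʳ _)

-- The values of the deficiencies are recovered from left to right, those of the weak exceedances from
-- right to left: at each step the available values agree and the code gives the rank of the chosen one.
module CrossingInjective {n s p s′ p′} (bij : IsBijection n s p) (bij′ : IsBijection n s′ p′)
  (same : ∀ {i} → i < n → crossingCode n s p i ≡ crossingCode n s′ p′ i) where
  private
    module σ where
      open IsBijection bij public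
      open CrossingHistory bij public
    module τ where
      open IsBijection bij′ public
      open CrossingHistory bij′ public

  exceeds : ∀ {i} → i < n → i ≤ s i → i ≤ s′ i
  exceeds {i} i<n = ⟦⟧-reflects (i ≤? s i) (i ≤? s′ i) (cong b₁ (same i<n))

  exceeds′ : ∀ {i} → i < n → i ≤ s′ i → i ≤ s i
  exceeds′ {i} i<n = ⟦⟧-reflects (i ≤? s′ i) (i ≤? s i) (cong b₁ (sym (same i<n)))

  closed : ∀ {i} → i < n → p i ≤ i → p′ i ≤ i
  closed {i} i<n = ⟦⟧-reflects (p i ≤? i) (p′ i ≤? i) (cong b₂ (same i<n))

  closed′ : ∀ {i} → i < n → p′ i ≤ i → p i ≤ i
  closed′ {i} i<n = ⟦⟧-reflects (p′ i ≤? i) (p i ≤? i) (cong b₂ (sym (same i<n)))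

  -- The values b < i that no position left of i has taken, the candidates for a deficiency at i,
  -- agree in both permutations.
  SamePending : ℕ → Set
  SamePending i = ∀ {b} → b < i → (i ≤ p b → i ≤ p′ b) × (i ≤ p′ b → i ≤ p b)

  deficiency-determined : ∀ {i} → i < n → SamePending i → s i < i → s i ≡ s′ i
  deficiency-determined {i} i<n pending si<i = rank-injective n (λ b → (b <? i) ×-dec (i ≤? p b))
    (σ.s<n i<n) (τ.s<n i<n) (si<i , ≤-reflexive (sym (σ.p∘s i<n)))
    (s′i<i , proj₂ (pending s′i<i) (≤-reflexive (sym (τ.p∘s i<n))))
    (trans (sym (σ.deficiency-x i<n si<i)) (trans (cong x (same i<n)) (trans (τ.deficiency-x i<n s′i<i)
      (sum-cong n λ {b} _ → ⟦⟧-cong (((b <? i) ×-dec (i ≤? p′ b)) ×-dec (s′ i <? b)) (((b <? i) ×-dec (i ≤? p b)) ×-dec (s′ i <? b))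
        (λ ((b<i , le) , lt) → (b<i , proj₂ (pending b<i) le) , lt)
        (λ ((b<i , le) , lt) → (b<i , proj₁ (pending b<i) le) , lt)))))
    where
    s′i<i : s′ i < i
    s′i<i = ≰⇒> λ le → <⇒≱ si<i (exceeds′ i<n le)

  -- From i to i + 1 the candidates change in two ways: the value i joins unless its position is at
  -- most i, which b₂ tells, and s i leaves if it is below i, in which case it is already
  -- determined.
  samePending : ∀ i → i ≤ n → SamePending i
  samePending zero    _   ()
  samePending (suc i) i<n {b} b<1+i with b ≟ i
  ... | yes refl = (λ lt → ≰⇒> (<⇒≱ lt ∘ closed′ i<n)) , (λ lt → ≰⇒> (<⇒≱ lt ∘ closed i<n))
  ... | no  b≢i  =
    (λ lt → ≤∧≢⇒< (proj₁ (pending b<i) (<⇒≤ lt)) λ i≡p′b → <⇒≢ lt (σ-from (trans (cong s′ i≡p′b) (τ.s∘p b<n)))) ,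
    (λ lt → ≤∧≢⇒< (proj₂ (pending b<i) (<⇒≤ lt)) λ i≡pb → <⇒≢ lt (τ-from (trans (cong s i≡pb) (σ.s∘p b<n))))
    where
    pending : SamePending i
    pending = samePending i (<⇒≤ i<n)
    b<i : b < i
    b<i = ≤∧≢⇒< (s≤s⁻¹ b<1+i) b≢i
    b<n : b < n
    b<n = <-trans b<i i<n
    σ-from : s′ i ≡ b → i ≡ p b
    σ-from eq = trans (sym (σ.p∘s i<n)) (cong p (trans (deficiency-determined i<n pending
      (≰⇒> λ le → <⇒≱ (subst (_< i) (sym eq) b<i) (exceeds i<n le))) eq))
    τ-from : s i ≡ b → i ≡ p′ b
    τ-from eq = trans (sym (τ.p∘s i<n)) (cong p′ (trans (sym (deficiency-determined i<n pending
      (subst (_< i) (sym eq) b<i))) eq))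

  SameFilled : ℕ → Set
  SameFilled i = ∀ {b} → i ≤ b → b < n → (p b < i → p′ b < i) × (p′ b < i → p b < i)

  SameAvailable : ℕ → Set
  SameAvailable i = ∀ {b} → i ≤ b → b < n → (p b ≤ i → p′ b ≤ i) × (p′ b ≤ i → p b ≤ i)

  filled⇒available : ∀ {i} → i < n → SameFilled (suc i) → SameAvailable i
  filled⇒available {i} i<n filled {b} i≤b b<n with b ≟ i
  -- The value i becomes a candidate only here; b₂ tells whether its position is at most i.
  ... | yes refl = closed i<n , closed′ i<n
  ... | no  b≢i  = let f , g = filled (≤∧≢⇒< i≤b (≢-sym b≢i)) b<n in
    (λ le → s≤s⁻¹ (f (s≤s le))) , (λ le → s≤s⁻¹ (g (s≤s le)))

  exceedance-determined : ∀ {i} → i < n → SameAvailable i → i ≤ s i → s i ≡ s′ i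
  exceedance-determined {i} i<n available i≤si = rank-injective n (λ b → (i ≤? b) ×-dec (p b ≤? i))
    (σ.s<n i<n) (τ.s<n i<n) (i≤si , ≤-reflexive (σ.p∘s i<n))
    (i≤s′i , proj₂ (available i≤s′i (τ.s<n i<n)) (≤-reflexive (τ.p∘s i<n)))
    (trans (sym (σ.exceedance-y i<n i≤si)) (trans (cong y (same i<n)) (trans (τ.exceedance-y i<n i≤s′i)
      (sum-cong n λ {b} b<n → ⟦⟧-cong (((i ≤? b) ×-dec (p′ b ≤? i)) ×-dec (s′ i <? b)) (((i ≤? b) ×-dec (p b ≤? i)) ×-dec (s′ i <? b))
        (λ ((i≤b , le) , lt) → (i≤b , proj₂ (available i≤b b<n) le) , lt)
        (λ ((i≤b , le) , lt) → (i≤b , proj₁ (available i≤b b<n) le) , lt)))))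
    where
    i≤s′i : i ≤ s′ i
    i≤s′i = exceeds i<n i≤si

  -- Downward induction on i with k = n - i. A value b ≥ i stands left of position i if its position
  -- is at most i and b is not s i; if s i ≥ i, then s i is already determined from the available
  -- values.
  sameFilled : ∀ k {i} → i + k ≡ n → SameFilled i
  sameFilled zero    {i} eq i≤b b<n = contradiction (subst (_≤ _) (trans (sym (+-identityʳ i)) eq) i≤b) (<⇒≱ b<n)
  sameFilled (suc k) {i} eq {b} i≤b b<n =
    (λ lt → ≤∧≢⇒< (proj₁ (available i≤b b<n) (<⇒≤ lt)) λ p′b≡i → <⇒≢ lt (σ-from (trans (cong s′ (sym p′b≡i)) (τ.s∘p b<n)))) ,
    (λ lt → ≤∧≢⇒< (proj₂ (available i≤b b<n) (<⇒≤ lt)) λ pb≡i → <⇒≢ lt (τ-from (trans (cong s (sym pb≡i)) (σ.s∘p b<n))))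
    where
    i<n : i < n
    i<n = ≤-<-trans i≤b b<n
    available : SameAvailable i
    available = filled⇒available i<n (sameFilled k (trans (sym (+-suc i k)) eq))
    σ-from : s′ i ≡ b → p b ≡ i
    σ-from eq = trans (cong p (sym (trans (exceedance-determined i<n available
      (exceeds′ i<n (subst (i ≤_) (sym eq) i≤b))) eq))) (σ.p∘s i<n)
    τ-from : s i ≡ b → p′ b ≡ i
    τ-from eq = trans (cong p′ (sym (trans (sym (exceedance-determined i<n available
      (subst (i ≤_) (sym eq) i≤b))) eq))) (τ.p∘s i<n)

  determined : ∀ {i} → i < n → s i ≡ s′ i
  determined {i} i<n with i ≤? s i
  ... | yes i≤si = exceedance-determined i<n
        (filled⇒available i<n (sameFilled (n ∸ suc i) (m+[n∸m]≡n i<n))) i≤si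
  ... | no  i≰si = deficiency-determined i<n (samePending i (<⇒≤ i<n)) (≰⇒> i≰si)

-- The patterns 31-2 and 2-31

previous : (ℕ → ℕ) → ℕ → ℕ
previous s zero    = 0
previous s (suc q) = s q

module _ (s p : ℕ → ℕ) where
  31-2? : ∀ v q → Dec (q < p v × v < s q × s (suc q) < v)
  31-2? v q = (q <? p v) ×-dec (v <? s q) ×-dec (s (suc q) <? v)

  2-31? : ∀ v q → Dec (p v < q × s (suc q) < v × v < s q)
  2-31? v q = (p v <? q) ×-dec (s (suc q) <? v) ×-dec (v <? s q)

-- Applied to words with a final letter s n = n, so that the last of the first n letters counts as
-- followed by a larger one; the value 0 of previous likewise makes a missing predecessor count as smaller.
patternCode : ℕ → (s p : ℕ → ℕ) → ℕ → Code
patternCode n s p v = code ⟦ v <? s (suc (p v)) ⟧ ⟦ previous s (p v) ≤? v ⟧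
  (sum n λ q → ⟦ 31-2? s p v q ⟧) (sum n λ q → ⟦ 2-31? s p v q ⟧)

module PatternHistory {n s p} (bij : IsBijection n s p) (s-end : s n ≡ n) where
  open IsBijection bij

  position : ∀ {q v} → q ≤ n → v < n → s q ≡ v → q ≡ p v
  position {q} q≤n v<n eq with q ≟ n
  ... | yes refl = contradiction (trans (sym eq) s-end) (<⇒≢ v<n)
  ... | no  q≢n  = trans (sym (p∘s (≤∧≢⇒< q≤n q≢n))) (cong p eq)

  -- At q = n this is the height of the path at v; shorter prefixes serve to locate smaller values
  -- relative to v in the decoding.
  drops : ℕ → ℕ → ℕ
  drops v q = sum q λ r → ⟦ (v ≤? s r) ×-dec (s (suc r) <? v) ⟧

  next<-complement : ∀ {v} → v < n → ⟦ s (suc (p v)) <? v ⟧ + ⟦ v <? s (suc (p v)) ⟧ ≡ 1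
  next<-complement {v} v<n = ⟦⟧-complement (_ <? _) (_ <? _)
    (λ ≮v → ≤∧≢⇒< (≮⇒≥ ≮v) λ eq → 1+n≢n (position (p<n v<n) v<n (sym eq))) <-asym

  previous-complement : ∀ v → ⟦ v <? previous s (p v) ⟧ + ⟦ previous s (p v) ≤? v ⟧ ≡ 1
  previous-complement v = ⟦⟧-complement (v <? _) (previous s (p v) ≤? _) ≮⇒≥ <⇒≱

  drops-mono : ∀ v {q r} → q ≤ r → drops v q ≤ drops v r
  drops-mono v {r = zero}  z≤n = ≤-refl
  drops-mono v {q} {suc r} q≤r with q ≟ suc r
  ... | yes refl = ≤-refl
  ... | no  q≢r  = ≤-trans (drops-mono v (s≤s⁻¹ (≤∧≢⇒< q≤r q≢r))) (m≤m+n (drops v r) _)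

  -- Between a letter at or above the level and a later letter below it the word must cross the
  -- level downwards: at the last step if the letter before it is still at least v, earlier
  -- otherwise.
  drops-< : ∀ {v q r} → q < r → v ≤ s q → s r < v → drops v q < drops v r
  drops-< {v} {q} {suc r} q<r v≤sq sr<v with ≤-<-connex v (s r)
  ... | inj₁ v≤sr = ≤-<-trans (drops-mono v (s≤s⁻¹ q<r)) (≤-reflexive (trans (+-comm 1 (drops v r))
                      (cong (drops v r +_) (sym (⟦⟧-true ((v ≤? s r) ×-dec (s (suc r) <? v)) (v≤sr , sr<v))))))
  ... | inj₂ sr<v′ = <-≤-trans
    (drops-< (≤∧≢⇒< (s≤s⁻¹ q<r) λ { refl → <⇒≱ sr<v′ v≤sq }) v≤sq sr<v′) (m≤m+n (drops v r) _)

  -- No position left of v carries the letter v, so s q ≥ v and s q > v agree there.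
  x≡drops : ∀ {v} → v < n → x (patternCode n s p v) ≡ drops v (p v)
  x≡drops {v} v<n = trans
    (sum-truncate n (<⇒≤ (p<n v<n)) λ {q} pv≤q _ → ⟦⟧-false (31-2? s p v q) λ (q<pv , _) → <⇒≱ q<pv pv≤q)
    (sum-cong (p v) λ {q} q<pv → ⟦⟧-cong (31-2? s p v q) ((v ≤? s q) ×-dec (s (suc q) <? v))
      (λ (_ , v<sq , lt) → <⇒≤ v<sq , lt)
      (λ (v≤sq , lt) → q<pv , ≤∧≢⇒< v≤sq (λ eq → <⇒≢ q<pv (position (<⇒≤ (<-trans q<pv (p<n v<n))) v<n (sym eq))) , lt))

  -- A drop across level v either starts at v or has v strictly inside its range, and then it forms
  -- a 31-2 or a 2-31 with v according to its side. The indicator of the first kind and b₁ add up to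
  -- 1.
  choices : ∀ {v} → v < n →
            suc (x (patternCode n s p v) + y (patternCode n s p v)) ≡ drops v n + ⟦ v <? s (suc (p v)) ⟧
  choices {v} v<n = begin
    suc (X + Y)
      ≡⟨ cong (_+ (X + Y)) (next<-complement v<n) ⟨
    (L + U) + (X + Y)
      ≡⟨ trans (+-assoc L U (X + Y)) (trans (cong (L +_) (+-comm U (X + Y))) (sym (+-assoc L (X + Y) U))) ⟩
    (L + (X + Y)) + U
      ≡⟨ cong₂ (λ a b → (a + b) + U) atV elsewhere ⟨
    (sum n (λ q → ⟦ (q ≟ p v) ×-dec (s (suc (p v)) <? v) ⟧) + sum n (λ q → ⟦ (v <? s q) ×-dec (s (suc q) <? v) ⟧)) + U
      ≡⟨ cong (_+ U) (sum-⊎ n (λ q → (v ≤? s q) ×-dec (s (suc q) <? v)) (λ q → (q ≟ p v) ×-dec (s (suc (p v)) <? v))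
           (λ q → (v <? s q) ×-dec (s (suc q) <? v)) split
           (λ { _ (refl , lt) → ≤-reflexive (sym (s∘p v<n)) , lt }) (λ _ (v<sq , lt) → <⇒≤ v<sq , lt)
           (λ { (refl , _) (v<sq , _) → <-irrefl (sym (s∘p v<n)) v<sq })) ⟨
    drops v n + U ∎
    where
    open ≡-Reasoning
    X = x (patternCode n s p v)
    Y = y (patternCode n s p v)
    L = ⟦ s (suc (p v)) <? v ⟧
    U = ⟦ v <? s (suc (p v)) ⟧
    split : ∀ {q} → q < n → v ≤ s q × s (suc q) < v → (q ≡ p v × s (suc (p v)) < v) ⊎ (v < s q × s (suc q) < v)
    split {q} q<n (v≤sq , lt) with q ≟ p v
    ... | yes refl = inj₁ (refl , lt)
    ... | no  q≢pv = inj₂ (≤∧≢⇒< v≤sq (λ eq → q≢pv (position (<⇒≤ q<n) v<n (sym eq))) , lt)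
    atV : sum n (λ q → ⟦ (q ≟ p v) ×-dec (s (suc (p v)) <? v) ⟧) ≡ L
    atV = sum-delta n (s (suc (p v)) <? v) (p<n v<n)
    sides : ∀ {q} → q < n → v < s q × s (suc q) < v → (q < p v × v < s q × s (suc q) < v) ⊎ (p v < q × s (suc q) < v × v < s q)
    sides {q} q<n (v<sq , lt) with <-cmp q (p v)
    ... | tri< q<pv _ _ = inj₁ (q<pv , v<sq , lt)
    ... | tri≈ _ refl _ = contradiction v<sq (<-irrefl (sym (s∘p v<n)))
    ... | tri> _ _ pv<q = inj₂ (pv<q , lt , v<sq)
    elsewhere : sum n (λ q → ⟦ (v <? s q) ×-dec (s (suc q) <? v) ⟧) ≡ X + Y
    elsewhere = sum-⊎ n (λ q → (v <? s q) ×-dec (s (suc q) <? v)) (31-2? s p v) (2-31? s p v)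
      sides (λ _ → proj₂) (λ _ (_ , lt , v<sq) → v<sq , lt) (λ (q<pv , _) (pv<q , _) → <-asym q<pv pv<q)

  -- Both sides count the positions r < q with s r ≥ v ≥ s (r + 1).
  drops-suc : ∀ {v} q → q ≤ n → v < n →
              drops (suc v) q + ⟦ p v <? q ⟧ * ⟦ s (suc (p v)) <? v ⟧ ≡
              drops v q + ⟦ p v ≤? q ⟧ * ⟦ v <? previous s (p v) ⟧
  drops-suc {v} q q≤n v<n = begin
    drops (suc v) q + ⟦ p v <? q ⟧ * ⟦ s (suc (p v)) <? v ⟧
      ≡⟨ cong (drops (suc v) q +_) (sum-delta-below q (p v) (s (suc (p v)) <? v)) ⟨
    drops (suc v) q + sum q (λ r → ⟦ (r ≟ p v) ×-dec (s (suc (p v)) <? v) ⟧)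
      ≡⟨ sum-⊎ q weak (λ r → (suc v ≤? s r) ×-dec (s (suc r) <? suc v)) (λ r → (r ≟ p v) ×-dec (s (suc (p v)) <? v))
           leaving (λ _ (v<sr , le) → <⇒≤ v<sr , s≤s⁻¹ le)
           (λ { _ (refl , lt) → ≤-reflexive (sym (s∘p v<n)) , <⇒≤ lt })
           (λ { (v<sr , _) (refl , _) → <-irrefl (sym (s∘p v<n)) v<sr }) ⟨
    sum q (λ r → ⟦ weak r ⟧)
      ≡⟨ sum-⊎ q weak (λ r → (v ≤? s r) ×-dec (s (suc r) <? v)) (λ r → (suc r ≟ p v) ×-dec (v <? s r))
           arriving (λ _ (v≤sr , lt) → v≤sr , <⇒≤ lt)
           (λ _ (1+r≡pv , v<sr) → <⇒≤ v<sr , ≤-reflexive (trans (cong s 1+r≡pv) (s∘p v<n)))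
           (λ (_ , lt) (1+r≡pv , _) → <-irrefl (trans (cong s 1+r≡pv) (s∘p v<n)) lt) ⟩
    drops v q + sum q (λ r → ⟦ (suc r ≟ p v) ×-dec (v <? s r) ⟧)
      ≡⟨ cong (drops v q +_) (before (p v)) ⟩
    drops v q + ⟦ p v ≤? q ⟧ * ⟦ v <? previous s (p v) ⟧ ∎
    where
    open ≡-Reasoning
    weak : ∀ r → Dec (v ≤ s r × s (suc r) ≤ v)
    weak r = (v ≤? s r) ×-dec (s (suc r) ≤? v)
    leaving : ∀ {r} → r < q → v ≤ s r × s (suc r) ≤ v → (suc v ≤ s r × s (suc r) < suc v) ⊎ (r ≡ p v × s (suc (p v)) < v)
    leaving {r} r<q (v≤sr , le) with v ≟ s r
    ... | no  v≢sr = inj₁ (≤∧≢⇒< v≤sr v≢sr , s≤s le)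
    ... | yes v≡sr with position (<⇒≤ (<-≤-trans r<q q≤n)) v<n (sym v≡sr)
    ...   | refl = inj₂ (refl , ≤∧≢⇒< le λ eq → 1+n≢n (position (≤-trans r<q q≤n) v<n eq))
    arriving : ∀ {r} → r < q → v ≤ s r × s (suc r) ≤ v → (v ≤ s r × s (suc r) < v) ⊎ (suc r ≡ p v × v < s r)
    arriving {r} r<q (v≤sr , le) with s (suc r) ≟ v
    ... | no  ≢v = inj₁ (v≤sr , ≤∧≢⇒< le ≢v)
    ... | yes ≡v = inj₂ (1+r≡pv , ≤∧≢⇒< v≤sr λ eq →
                     1+n≢n (trans 1+r≡pv (sym (position (<⇒≤ (<-≤-trans r<q q≤n)) v<n (sym eq)))))
      where 1+r≡pv = position (≤-trans r<q q≤n) v<n ≡v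
    -- A drop ending at v starts at position p v - 1, hence lies in the prefix exactly when p v ≤ q,
    -- against p v < q for a drop starting at v. If v is the first letter, `previous s 0 = 0` makes
    -- the factor vanish.
    before : ∀ m → sum q (λ r → ⟦ (suc r ≟ m) ×-dec (v <? s r) ⟧) ≡ ⟦ m ≤? q ⟧ * ⟦ v <? previous s m ⟧
    before zero    = trans (sum-0 q λ {r} _ → ⟦⟧-false ((suc r ≟ 0) ×-dec (v <? s r)) λ ()) (sym (*-zeroʳ ⟦ 0 ≤? q ⟧))
    before (suc m) = trans
      (sum-cong q λ {r} _ → ⟦⟧-cong ((suc r ≟ suc m) ×-dec (v <? s r)) ((r ≟ m) ×-dec (v <? s m))
        (λ { (refl , lt) → refl , lt }) (λ { (refl , lt) → refl , lt }))
      (sum-delta-below q m (v <? s m))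

  -- Raising the level from v to v + 1 loses the drop starting at v and gains the drop ending at v;
  -- complementing both indicators turns them into b₁ and b₂.
  drops-step : ∀ {v} → v < n → drops (suc v) n + ⟦ previous s (p v) ≤? v ⟧ ≡ drops v n + ⟦ v <? s (suc (p v)) ⟧
  drops-step {v} v<n = +-cancelʳ-≡ L _ _ (begin
    drops (suc v) n + b + L
      ≡⟨ trans (+-assoc (drops (suc v) n) b L) (trans (cong (drops (suc v) n +_) (+-comm b L)) (sym (+-assoc _ L b))) ⟩
    drops (suc v) n + L + b
      ≡⟨ cong (λ u → drops (suc v) n + u + b) (trans (cong (_* L) (⟦⟧-true (p v <? n) (p<n v<n))) (*-identityˡ L)) ⟨
    drops (suc v) n + ⟦ p v <? n ⟧ * L + b
      ≡⟨ cong (_+ b) (drops-suc n ≤-refl v<n) ⟩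
    drops v n + ⟦ p v ≤? n ⟧ * E + b
      ≡⟨ cong (λ u → drops v n + u + b) (trans (cong (_* E) (⟦⟧-true (p v ≤? n) (<⇒≤ (p<n v<n)))) (*-identityˡ E)) ⟩
    drops v n + E + b
      ≡⟨ trans (+-assoc (drops v n) E b) (cong (drops v n +_) (previous-complement v)) ⟩
    drops v n + 1
      ≡⟨ cong (drops v n +_) (next<-complement v<n) ⟨
    drops v n + (L + U)
      ≡⟨ trans (cong (drops v n +_) (+-comm L U)) (sym (+-assoc (drops v n) U L)) ⟩
    drops v n + U + L ∎)
    where
    open ≡-Reasoning
    L = ⟦ s (suc (p v)) <? v ⟧
    U = ⟦ v <? s (suc (p v)) ⟧
    E = ⟦ v <? previous s (p v) ⟧
    b = ⟦ previous s (p v) ≤? v ⟧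

  isHistory : IsHistory n (patternCode n s p) (λ v → drops v n)
  isHistory = record
    { bit₁   = λ {v} _ → ⟦⟧≤1 (v <? s (suc (p v)))
    ; bit₂   = λ {v} _ → ⟦⟧≤1 (previous s (p v) ≤? v)
    ; choice = choices
    ; step   = drops-step
    ; end    = sum-0 n λ {r} r<n → ⟦⟧-false ((n ≤? s r) ×-dec (s (suc r) <? n)) λ (n≤sr , _) → <⇒≱ (s<n r<n) n≤sr
    }

  drops-0 : drops 0 n ≡ 0
  drops-0 = sum-0 n λ {r} _ → ⟦⟧-false ((0 ≤? s r) ×-dec (s (suc r) <? 0)) λ ()

  left-of : ∀ {v a} → v < n → a < v → p a < p v → drops v (p a) ≤ x (patternCode n s p v)
  left-of {v} v<n _ pa<pv = ≤-trans (drops-mono v (<⇒≤ pa<pv)) (≤-reflexive (sym (x≡drops v<n)))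

  right-of : ∀ {v a} → v < n → a < v → p v < p a → x (patternCode n s p v) < drops v (p a)
  right-of v<n a<v pv<pa = subst (_< _) (sym (x≡drops v<n))
    (drops-< pv<pa (≤-reflexive (sym (s∘p v<n))) (subst (_< _) (sym (s∘p (<-trans a<v v<n))) a<v))

  left-of? : ∀ {v a} → v < n → a < v → ⟦ p a <? p v ⟧ ≡ ⟦ drops v (p a) ≤? x (patternCode n s p v) ⟧
  left-of? {v} {a} v<n a<v = ⟦⟧-cong (_ <? _) (_ ≤? _) (left-of v<n a<v) λ le →
    ≤∧≢⇒< (≮⇒≥ λ pv<pa → <⇒≱ (right-of v<n a<v pv<pa) le) (<⇒≢ a<v ∘ p-inj (<-trans a<v v<n) v<n)

  right-of? : ∀ {v a} → v < n → a < v → ⟦ p v <? p a ⟧ ≡ ⟦ x (patternCode n s p v) <? drops v (p a) ⟧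
  right-of? {v} {a} v<n a<v = ⟦⟧-cong (_ <? _) (_ <? _) (right-of v<n a<v) λ lt →
    ≤∧≢⇒< (≮⇒≥ λ pa<pv → <⇒≱ lt (left-of v<n a<v pa<pv)) (<⇒≢ a<v ∘ sym ∘ p-inj v<n (<-trans a<v v<n))

  -- The prefix of length p v contains a drop ending at v but not one starting at v.
  drops-suc-new : ∀ {v} → v < n → drops (suc v) (p v) ≡ x (patternCode n s p v) + ⟦ v <? previous s (p v) ⟧
  drops-suc-new {v} v<n = begin
    drops (suc v) (p v)
      ≡⟨ trans (cong (drops (suc v) (p v) +_) (cong (_* L) (⟦⟧-false (p v <? p v) (<-irrefl refl)))) (+-identityʳ _) ⟨
    drops (suc v) (p v) + ⟦ p v <? p v ⟧ * L
      ≡⟨ drops-suc (p v) (<⇒≤ (p<n v<n)) v<n ⟩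
    drops v (p v) + ⟦ p v ≤? p v ⟧ * E
      ≡⟨ cong₂ _+_ (sym (x≡drops v<n)) (trans (cong (_* E) (⟦⟧-true (p v ≤? p v) ≤-refl)) (*-identityˡ E)) ⟩
    x (patternCode n s p v) + E ∎
    where
    open ≡-Reasoning
    L = ⟦ s (suc (p v)) <? v ⟧
    E = ⟦ v <? previous s (p v) ⟧

  -- For a ≠ v the conditions p v ≤ p a and p v < p a coincide, so a single comparison governs both
  -- corrections.
  drops-suc-old : ∀ {v a} → v < n → a < v →
    drops (suc v) (p a) + ⟦ p v <? p a ⟧ * ⟦ s (suc (p v)) <? v ⟧ ≡
    drops v (p a) + ⟦ p v <? p a ⟧ * ⟦ v <? previous s (p v) ⟧
  drops-suc-old {v} {a} v<n a<v = trans (drops-suc (p a) (<⇒≤ (p<n a<n)) v<n)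
    (cong (λ u → drops v (p a) + u * ⟦ v <? previous s (p v) ⟧) (⟦⟧-cong (_ ≤? _) (_ <? _)
      (λ le → ≤∧≢⇒< le (<⇒≢ a<v ∘ sym ∘ p-inj v<n a<n)) <⇒≤))
    where a<n = <-trans a<v v<n

  -- The values left of a fill exactly the positions below p a; hence the relative order of all
  -- values fixes every position.
  rank≡position : ∀ {a} → a < n → sum n (λ b → ⟦ p b <? p a ⟧) ≡ p a
  rank≡position {a} a<n = trans (sum-positions λ q → ⟦ q <? p a ⟧) (sum-<? n (<⇒≤ (p<n a<n)))

-- Induction on v: the codes of the values below v determine both the relative order of these values and
-- how many drops across the level v precede each of them.  The value a < v stands to the left of v if and
-- only if at most x of these drops precede it, since s falls from v to a below the level otherwise.
module PatternInjective {n s p s′ p′} (bij : IsBijection n s p) (bij′ : IsBijection n s′ p′)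
  (s-end : s n ≡ n) (s′-end : s′ n ≡ n)
  (same : ∀ {v} → v < n → patternCode n s p v ≡ patternCode n s′ p′ v) where
  private
    module σ where
      open IsBijection bij public
      open PatternHistory bij s-end public
    module τ where
      open IsBijection bij′ public
      open PatternHistory bij′ s′-end public

  same-next : ∀ {v} → v < n → ⟦ s (suc (p v)) <? v ⟧ ≡ ⟦ s′ (suc (p′ v)) <? v ⟧
  same-next {v} v<n = +-cancelʳ-≡ ⟦ v <? s (suc (p v)) ⟧ _ _ (trans (σ.next<-complement v<n)
    (sym (trans (cong (⟦ s′ (suc (p′ v)) <? v ⟧ +_) (cong b₁ (same v<n))) (τ.next<-complement v<n))))

  same-previous : ∀ {v} → v < n → ⟦ v <? previous s (p v) ⟧ ≡ ⟦ v <? previous s′ (p′ v) ⟧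
  same-previous {v} v<n = +-cancelʳ-≡ ⟦ previous s (p v) ≤? v ⟧ _ _ (trans (σ.previous-complement v)
    (sym (trans (cong (⟦ v <? previous s′ (p′ v) ⟧ +_) (cong b₂ (same v<n))) (τ.previous-complement v))))

  record SameBelow (v : ℕ) : Set where
    field
      order : ∀ {a b} → a < v → b < v → ⟦ p a <? p b ⟧ ≡ ⟦ p′ a <? p′ b ⟧
      drops : ∀ {a} → a < v → σ.drops v (p a) ≡ τ.drops v (p′ a)

  sameBelow : ∀ v → v ≤ n → SameBelow v
  sameBelow zero    _   = record { order = λ () ; drops = λ () }
  sameBelow (suc v) v<n = record { order = order′ ; drops = drops′ }
    where
    open SameBelow (sameBelow v (<⇒≤ v<n))
    before-new : ∀ {a} → a < v → ⟦ p a <? p v ⟧ ≡ ⟦ p′ a <? p′ v ⟧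
    before-new a<v = trans (σ.left-of? v<n a<v)
      (trans (cong₂ (λ d c → ⟦ d ≤? x c ⟧) (drops a<v) (same v<n)) (sym (τ.left-of? v<n a<v)))
    after-new : ∀ {a} → a < v → ⟦ p v <? p a ⟧ ≡ ⟦ p′ v <? p′ a ⟧
    after-new a<v = trans (σ.right-of? v<n a<v)
      (trans (cong₂ (λ d c → ⟦ x c <? d ⟧) (drops a<v) (same v<n)) (sym (τ.right-of? v<n a<v)))
    order′ : ∀ {a b} → a < suc v → b < suc v → ⟦ p a <? p b ⟧ ≡ ⟦ p′ a <? p′ b ⟧
    order′ {a} {b} a≤v b≤v with m<1+n⇒m<n∨m≡n a≤v | m<1+n⇒m<n∨m≡n b≤v
    ... | inj₁ a<v  | inj₁ b<v  = order a<v b<v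
    ... | inj₁ a<v  | inj₂ refl = before-new a<v
    ... | inj₂ refl | inj₁ b<v  = after-new b<v
    ... | inj₂ refl | inj₂ refl = trans (⟦⟧-false (p v <? p v) (<-irrefl refl)) (sym (⟦⟧-false (p′ v <? p′ v) (<-irrefl refl)))
    drops′ : ∀ {a} → a < suc v → σ.drops (suc v) (p a) ≡ τ.drops (suc v) (p′ a)
    drops′ {a} a≤v with m<1+n⇒m<n∨m≡n a≤v
    ... | inj₂ refl = trans (σ.drops-suc-new v<n)
                        (trans (cong₂ _+_ (cong x (same v<n)) (same-previous v<n)) (sym (τ.drops-suc-new v<n)))
    ... | inj₁ a<v  = +-cancelʳ-≡ (⟦ p v <? p a ⟧ * ⟦ s (suc (p v)) <? v ⟧) _ _ (begin
      σ.drops (suc v) (p a) + ⟦ p v <? p a ⟧ * ⟦ s (suc (p v)) <? v ⟧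
        ≡⟨ σ.drops-suc-old v<n a<v ⟩
      σ.drops v (p a) + ⟦ p v <? p a ⟧ * ⟦ v <? previous s (p v) ⟧
        ≡⟨ cong₂ _+_ (drops a<v) (cong₂ _*_ (after-new a<v) (same-previous v<n)) ⟩
      τ.drops v (p′ a) + ⟦ p′ v <? p′ a ⟧ * ⟦ v <? previous s′ (p′ v) ⟧
        ≡⟨ τ.drops-suc-old v<n a<v ⟨
      τ.drops (suc v) (p′ a) + ⟦ p′ v <? p′ a ⟧ * ⟦ s′ (suc (p′ v)) <? v ⟧
        ≡⟨ cong (τ.drops (suc v) (p′ a) +_) (cong₂ _*_ (after-new a<v) (same-next v<n)) ⟨
      τ.drops (suc v) (p′ a) + ⟦ p v <? p a ⟧ * ⟦ s (suc (p v)) <? v ⟧ ∎)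
      where open ≡-Reasoning

  same-position : ∀ {v} → v < n → p v ≡ p′ v
  same-position v<n = trans (sym (σ.rank≡position v<n))
    (trans (sum-cong n λ b<n → order b<n v<n) (τ.rank≡position v<n))
    where open SameBelow (sameBelow n ≤-refl)

  determined : ∀ {i} → i < n → s i ≡ s′ i
  determined i<n = trans (sym (τ.s∘p (σ.s<n i<n)))
    (cong s′ (trans (sym (same-position (σ.s<n i<n))) (σ.p∘s i<n)))

-- From words over Fin n to functions on ℕ

tally : (A → ℕ) → List A → ℕ
tally f xs = ListAction.sum (map f xs)

tally-filter : {P : A → Set} (P? : Decidable P) → ∀ xs → length (filter P? xs) ≡ tally (λ x → ⟦ P? x ⟧) xs
tally-filter P? []       = refl
tally-filter P? (x ∷ xs) with P? x
... | yes _ = cong suc (tally-filter P? xs)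
... | no  _ = tally-filter P? xs

tally-++ : ∀ (f : A → ℕ) xs {ys} → tally f (xs ++ ys) ≡ tally f xs + tally f ys
tally-++ f []       = refl
tally-++ f (x ∷ xs) = trans (cong (f x +_) (tally-++ f xs)) (sym (+-assoc (f x) _ _))

tally-concatMap : ∀ (f : A′ → ℕ) (g : A → List A′) xs → tally f (concatMap g xs) ≡ tally (tally f ∘ g) xs
tally-concatMap f g []       = refl
tally-concatMap f g (x ∷ xs) = trans (tally-++ f (g x)) (cong (tally f (g x) +_) (tally-concatMap f g xs))

tally-map : ∀ (f : A′ → ℕ) (g : A → A′) xs → tally f (map g xs) ≡ tally (f ∘ g) xs
tally-map f g xs = cong ListAction.sum (sym (List.map-∘ xs))

tally-tabulate : ∀ n (f : A → ℕ) (h : Fin n → A) {g : ℕ → ℕ} → (∀ i → f (h i) ≡ g (toℕ i)) →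
                 tally f (List.tabulate h) ≡ sum n g
tally-tabulate zero    f h eq = refl
tally-tabulate (suc n) f h {g} eq = trans
  (cong₂ _+_ (eq zero) (tally-tabulate n f (h ∘ suc) (eq ∘ suc))) (sym (sum-first n g))

tally-allFin : ∀ n {f : Fin n → ℕ} {g : ℕ → ℕ} → (∀ i → f i ≡ g (toℕ i)) → tally f (allFin n) ≡ sum n g
tally-allFin n = tally-tabulate n _ id

tally-applyUpTo : ∀ n (f : A → ℕ) (c : ℕ → A) → tally f (applyUpTo c n) ≡ sum n (f ∘ c)
tally-applyUpTo zero    f c = refl
tally-applyUpTo (suc n) f c = trans (cong (f (c 0) +_) (tally-applyUpTo n f (c ∘ suc))) (sym (sum-first n (f ∘ c)))

module _ {n : ℕ} where

  count₁ : {P : Fin n → Set} (P? : Decidable P) {g : ℕ → ℕ} →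
           (∀ i → ⟦ P? i ⟧ ≡ g (toℕ i)) → # P? ≡ sum n g
  count₁ P? eq = trans (tally-filter P? (allFin n)) (tally-allFin n eq)

  count₂ : {R : Fin n → Fin n → Set} (R? : ∀ i j → Dec (R i j)) {g : ℕ → ℕ → ℕ} →
           (∀ i j → ⟦ R? i j ⟧ ≡ g (toℕ i) (toℕ j)) → #₂ R? ≡ sum n λ i → sum n (g i)
  count₂ R? eq = trans (tally-filter _ (concatMap (λ i → map (i ,_) (allFin n)) (allFin n)))
    (trans (tally-concatMap _ _ (allFin n)) (tally-allFin n λ i →
      trans (tally-map _ _ (allFin n)) (tally-allFin n (eq i))))

  count₃ : {R : Fin n → Fin n → Fin n → Set} (R? : ∀ i j k → Dec (R i j k)) {g : ℕ → ℕ → ℕ → ℕ} →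
           (∀ i j k → ⟦ R? i j k ⟧ ≡ g (toℕ i) (toℕ j) (toℕ k)) →
           #₃ R? ≡ sum n λ i → sum n λ j → sum n (g i j)
  count₃ R? eq = trans
    (tally-filter _ (concatMap (λ i → concatMap (λ j → map (λ k → i , j , k) (allFin n)) (allFin n)) (allFin n)))
    (trans (tally-concatMap _ _ (allFin n)) (tally-allFin n λ i →
    trans (tally-concatMap _ _ (allFin n)) (tally-allFin n λ j →
    trans (tally-map _ _ (allFin n)) (tally-allFin n (eq i j)))))

-- The letter d fills all positions beyond the end of the word.
letter : ∀ {m n} → ℕ → Vec (Fin m) n → ℕ → ℕ
letter d []      q       = d
letter d (a ∷ w) zero    = toℕ a
letter d (a ∷ w) (suc q) = letter d w q

letter-toℕ : ∀ {m n d} (w : Vec (Fin m) n) i → letter d w (toℕ i) ≡ toℕ (lookup w i)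
letter-toℕ (a ∷ w) zero    = refl
letter-toℕ (a ∷ w) (suc i) = letter-toℕ w i

letter-end : ∀ {m n d} (w : Vec (Fin m) n) → letter d w n ≡ d
letter-end []      = refl
letter-end (a ∷ w) = letter-end w

onFin : ∀ {n} (P : ℕ → Set) → (∀ (i : Fin n) → P (toℕ i)) → ∀ {q} → q < n → P q
onFin P f q<n = subst P (toℕ-fromℕ< q<n) (f (fromℕ< q<n))

-- Pigeonhole: if a were missed, `punchOut` would inject n + 1 positions into n values.
surjective : ∀ {n} (w : Vec (Fin n) n) → IsPerm w → ∀ a → ∃ λ i → lookup w i ≡ a
surjective {suc n} w perm a with any? (λ i → lookup w i Fin.≟ a)
... | yes found = found
... | no  none  = contradiction
  (injective⇒≤ {f = λ i → punchOut (missed i)} λ {i} {j} eq → perm i j (punchOut-injective (missed i) (missed j) eq))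
  1+n≰n
  where
  missed : ∀ i → a ≢ lookup w i
  missed i eq = none (i , sym eq)

module _ {n : ℕ} (w : Vec (Fin n) n) where

  word : ℕ → ℕ
  word = letter n w

  place : ℕ → ℕ
  place v with any? (λ i → toℕ (lookup w i) ≟ v)
  ... | yes (i , _) = toℕ i
  ... | no  _       = 0

  crossingWord : List Code
  crossingWord = applyUpTo (crossingCode n word place) n

  patternWord : List Code
  patternWord = applyUpTo (patternCode n word place) n

  word-toℕ : ∀ i → toℕ (lookup w i) ≡ word (toℕ i)
  word-toℕ i = sym (letter-toℕ w i)

module _ {n : ℕ} (w : Vec (Fin n) n) (perm : IsPerm w) where

  place-lookup : ∀ i → place w (toℕ (lookup w i)) ≡ toℕ i
  place-lookup i with any? (λ j → toℕ (lookup w j) ≟ toℕ (lookup w i))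
  ... | yes (j , eq) = cong toℕ (perm j i (toℕ-injective eq))
  ... | no  none     = contradiction (i , refl) none

  place-word : ∀ i → place w (word w (toℕ i)) ≡ toℕ i
  place-word i = trans (cong (place w) (letter-toℕ w i)) (place-lookup i)

  bijection : IsBijection n (word w) (place w)
  bijection = record
    { s<n = onFin (λ q → word w q < n) λ i → subst (_< n) (word-toℕ w i) (toℕ<n (lookup w i))
    ; p<n = onFin (λ v → place w v < n) λ a → subst (_< n) (sym (place-value a)) (toℕ<n (position a))
    ; s∘p = onFin (λ v → word w (place w v) ≡ v) λ a → trans (cong (word w) (place-value a))
        (trans (letter-toℕ w (position a)) (cong toℕ (proj₂ (surjective w perm a))))
    ; p∘s = onFin (λ q → place w (word w q) ≡ q) place-word
    }
    where
    position : Fin n → Fin n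
    position a = proj₁ (surjective w perm a)
    place-value : ∀ a → place w (toℕ a) ≡ toℕ (position a)
    place-value a = trans (cong (place w ∘ toℕ) (sym (proj₂ (surjective w perm a)))) (place-lookup (position a))

word-injective : ∀ {n} {u w : Vec (Fin n) n} → (∀ {q} → q < n → word u q ≡ word w q) → u ≡ w
word-injective {u = u} {w} eq = trans (sym (tabulate∘lookup u)) (trans
  (tabulate-cong λ i → toℕ-injective (trans (word-toℕ u i) (trans (eq (toℕ<n i)) (sym (word-toℕ w i)))))
  (tabulate∘lookup w))

applyUpTo-injective : ∀ n {c d : ℕ → A} → applyUpTo c n ≡ applyUpTo d n → ∀ {i} → i < n → c i ≡ d i
applyUpTo-injective (suc n) eq {zero}  _   = List.∷-injectiveˡ eq
applyUpTo-injective (suc n) eq {suc i} i<n = applyUpTo-injective n (List.∷-injectiveʳ eq) (s≤s⁻¹ i<n)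

-- Both encodings enumerate the histories

crossingWords↭histories : ∀ n → histories n 0 ↭ map crossingWord (perms n)
crossingWords↭histories n = histories↭codes n crossingWord
  (λ {u} {w} perm-u perm-w eq → word-injective
    (CrossingInjective.determined (bijection u perm-u) (bijection w perm-w) (applyUpTo-injective n eq)))
  (λ {w} perm → let open CrossingHistory (bijection w perm) in
    subst (λ h → crossingWord w ∈ histories n h) open-arcs-0 (∈-histories n isHistory))

patternWords↭histories : ∀ n → histories n 0 ↭ map patternWord (perms n)
patternWords↭histories n = histories↭codes n patternWord
  (λ {u} {w} perm-u perm-w eq → word-injective
    (PatternInjective.determined (bijection u perm-u) (bijection w perm-w) (letter-end u) (letter-end w)
      (applyUpTo-injective n eq)))
  (λ {w} perm → let open PatternHistory (bijection w perm) (letter-end w) in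
    subst (λ h → patternWord w ∈ histories n h) drops-0 (∈-histories n isHistory))

-- The statistics as totals over the letters of a code

module _ {n : ℕ} (w : Vec (Fin n) n) where
  private
    s = word w
    c = crossingCode n s (place w)
    σ≡ = word-toℕ w

  wex≡ : wex w ≡ tally b₁ (crossingWord w)
  wex≡ = trans (count₁ _ λ i → cong (λ a → ⟦ toℕ i ≤? a ⟧) (σ≡ i)) (sym (tally-applyUpTo n b₁ c))

  crossings≡ : crossings w ≡ tally x (crossingWord w)
  crossings≡ = trans (cong₂ _+_
    (count₂ _ λ i j → cong₂ (λ a b → ⟦ (toℕ j <? toℕ i) ×-dec (toℕ i ≤? b) ×-dec (b <? a) ⟧) (σ≡ i) (σ≡ j))
    (count₂ _ λ i j → cong₂ (λ a b → ⟦ (toℕ i <? toℕ j) ×-dec (b <? toℕ i) ×-dec (a <? b) ⟧) (σ≡ i) (σ≡ j)))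
    (trans (sym (sum-+ n)) (sym (tally-applyUpTo n x c)))

  nestings≡ : nestings w ≡ tally y (crossingWord w)
  nestings≡ = trans (cong₂ _+_
    (count₂ _ λ i j → cong₂ (λ a b → ⟦ (toℕ j <? toℕ i) ×-dec (toℕ i ≤? a) ×-dec (a <? b) ⟧) (σ≡ i) (σ≡ j))
    (count₂ _ λ i j → cong₂ (λ a b → ⟦ (toℕ i <? toℕ j) ×-dec (a <? toℕ i) ×-dec (b <? a) ⟧) (σ≡ i) (σ≡ j)))
    (trans (sym (sum-+ n)) (sym (tally-applyUpTo n y c)))

module _ {n : ℕ} (w : Vec (Fin n) n) (perm : IsPerm w) where
  private
    s = word w
    p = place w
    c = patternCode n s p
    σ≡ = word-toℕ w
  open IsBijection (bijection w perm)

  last-not-below : ∀ {j} → j < n → ¬ s n < s j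
  last-not-below j<n lt = <-asym (s<n j<n) (subst (_< s _) (letter-end w) lt)

  sum-by-value : ∀ (f : ℕ → ℕ → ℕ) → sum n (λ v → f v (p v)) ≡ sum n (λ q → f (s q) q)
  sum-by-value f = trans (sym (sum-values λ v → f v (p v))) (sum-cong n λ {q} q<n → cong (f (s q)) (p∘s q<n))

  -- With the sentinel appended, each of the n letters is followed by a smaller or a larger one. The
  -- last letter always counts as an ascent, which makes the total n rather than n - 1.
  descents+ascents : descents w + tally b₁ (patternWord w) ≡ n
  descents+ascents = begin
    descents w + tally b₁ (patternWord w)
      ≡⟨ cong₂ _+_
           (trans (count₂ _ λ i j → cong₂ (λ a b → ⟦ (suc (toℕ i) ≟ toℕ j) ×-dec (b <? a) ⟧) (σ≡ i) (σ≡ j))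
             (sum-cong n λ {i} i<n → sum-contract n (λ j → s j <? s i) i<n (last-not-below i<n)))
           (trans (tally-applyUpTo n b₁ c) (sum-by-value λ v q → ⟦ v <? s (suc q) ⟧)) ⟩
    sum n (λ q → ⟦ s (suc q) <? s q ⟧) + sum n (λ q → ⟦ s q <? s (suc q) ⟧)
      ≡⟨ sum-+ n ⟨
    sum n (λ q → ⟦ s (suc q) <? s q ⟧ + ⟦ s q <? s (suc q) ⟧)
      ≡⟨ sum-cong n (λ {q} q<n → ⟦⟧-complement (s (suc q) <? s q) (s q <? s (suc q))
           (λ ≮ → ≤∧≢⇒< (≮⇒≥ ≮) (distinct q<n)) <-asym) ⟩
    sum n (λ _ → 1)
      ≡⟨ sum-1 n ⟩
    n ∎
    where
    open ≡-Reasoning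
    distinct : ∀ {q} → q < n → s q ≢ s (suc q)
    distinct {q} q<n eq with m≤n⇒m<n∨m≡n q<n
    ... | inj₁ 1+q<n = 1+n≢n (sym (s-inj q<n 1+q<n eq))
    ... | inj₂ refl  = <⇒≢ (s<n q<n) (trans eq (letter-end w))

  -- The position i' = i + 1 is contracted, where the sentinel is harmless because it is never below
  -- another letter; the sum is then regrouped by the value playing the role of 2.
  pat31-2≡ : pat31-2 w ≡ tally x (patternWord w)
  pat31-2≡ = begin
    pat31-2 w
      ≡⟨ count₃ _ (λ i k j → cong₂ (λ a bc → ⟦ (suc (toℕ i) ≟ toℕ k) ×-dec (toℕ i <? toℕ j) ×-dec
           (proj₁ bc <? a) ×-dec (proj₂ bc <? proj₁ bc) ⟧) (σ≡ i) (cong₂ _,_ (σ≡ j) (σ≡ k))) ⟩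
    sum n (λ i → sum n λ k → sum n λ j → ⟦ (suc i ≟ k) ×-dec (i <? j) ×-dec (s j <? s i) ×-dec (s k <? s j) ⟧)
      ≡⟨ sum-cong n (λ {i} i<n → trans (sum-swap n n) (sum-cong n λ {j} j<n →
           sum-contract n (λ k → (i <? j) ×-dec (s j <? s i) ×-dec (s k <? s j)) i<n (last-not-below j<n ∘ proj₂ ∘ proj₂))) ⟩
    sum n (λ i → sum n λ j → ⟦ (i <? j) ×-dec (s j <? s i) ×-dec (s (suc i) <? s j) ⟧)
      ≡⟨ sum-swap n n ⟩
    sum n (λ j → sum n λ i → ⟦ (i <? j) ×-dec (s j <? s i) ×-dec (s (suc i) <? s j) ⟧)
      ≡⟨ sum-by-value (λ v j → sum n λ i → ⟦ (i <? j) ×-dec (v <? s i) ×-dec (s (suc i) <? v) ⟧) ⟨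
    sum n (x ∘ c)
      ≡⟨ tally-applyUpTo n x c ⟨
    tally x (patternWord w) ∎
    where open ≡-Reasoning

  pat2-31≡ : pat2-31 w ≡ tally y (patternWord w)
  pat2-31≡ = begin
    pat2-31 w
      ≡⟨ count₃ _ (λ i j k → cong₂ (λ a bc → ⟦ (suc (toℕ j) ≟ toℕ k) ×-dec (toℕ i <? toℕ j) ×-dec
           (proj₂ bc <? a) ×-dec (a <? proj₁ bc) ⟧) (σ≡ i) (cong₂ _,_ (σ≡ j) (σ≡ k))) ⟩
    sum n (λ i → sum n λ j → sum n λ k → ⟦ (suc j ≟ k) ×-dec (i <? j) ×-dec (s k <? s i) ×-dec (s i <? s j) ⟧)
      ≡⟨ sum-cong n (λ {i} i<n → sum-cong n λ {j} j<n →
           sum-contract n (λ k → (i <? j) ×-dec (s k <? s i) ×-dec (s i <? s j)) j<n (last-not-below i<n ∘ proj₁ ∘ proj₂)) ⟩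
    sum n (λ i → sum n λ j → ⟦ (i <? j) ×-dec (s (suc j) <? s i) ×-dec (s i <? s j) ⟧)
      ≡⟨ sum-by-value (λ v i → sum n λ j → ⟦ (i <? j) ×-dec (s (suc j) <? v) ×-dec (v <? s j) ⟧) ⟨
    sum n (y ∘ c)
      ≡⟨ tally-applyUpTo n y c ⟨
    tally y (patternWord w) ∎
    where open ≡-Reasoning

-- Equality of the joint distributions

totals? : ∀ k ℓ m (cs : List Code) → Dec (tally b₁ cs ≡ k × tally x cs ≡ ℓ × tally y cs ≡ m)
totals? k ℓ m cs = (tally b₁ cs ≟ k) ×-dec (tally x cs ≟ ℓ) ×-dec (tally y cs ≟ m)

length-filter-map : {P : A → Set} (P? : Decidable P) {Q : A′ → Set} (Q? : Decidable Q) (f : A → A′) → ∀ xs →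
                    (∀ {a} → a ∈ xs → ⟦ P? a ⟧ ≡ ⟦ Q? (f a) ⟧) →
                    length (filter P? xs) ≡ length (filter Q? (map f xs))
length-filter-map P? Q? f xs eq = begin
  length (filter P? xs)         ≡⟨ tally-filter P? xs ⟩
  tally (λ a → ⟦ P? a ⟧) xs     ≡⟨ tally-cong xs eq ⟩
  tally (λ a → ⟦ Q? (f a) ⟧) xs ≡⟨ tally-map _ f xs ⟨
  tally (λ b → ⟦ Q? b ⟧) (map f xs) ≡⟨ tally-filter Q? (map f xs) ⟨
  length (filter Q? (map f xs)) ∎
  where
  open ≡-Reasoning
  tally-cong : ∀ xs {g h} → (∀ {a} → a ∈ xs → g a ≡ h a) → tally g xs ≡ tally h xs
  tally-cong []       eq = refl
  tally-cong (x ∷ xs) eq = cong₂ _+_ (eq (here refl)) (tally-cong xs (eq ∘ there))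

theorem1 : (n k ℓ m : ℕ) → B n k ℓ m ≡ D n k ℓ m
theorem1 n k ℓ m = begin
  B n k ℓ m
    ≡⟨ length-filter-map _ (totals? k ℓ m) crossingWord (perms n) (λ {w} _ → cong₂ (λ a bc →
         ⟦ (a ≟ k) ×-dec (proj₁ bc ≟ ℓ) ×-dec (proj₂ bc ≟ m) ⟧) (wex≡ w) (cong₂ _,_ (crossings≡ w) (nestings≡ w))) ⟩
  length (filter (totals? k ℓ m) (map crossingWord (perms n)))
    ≡⟨ ↭-length (filter-↭ (totals? k ℓ m) (crossingWords↭histories n)) ⟨
  length (filter (totals? k ℓ m) (histories n 0))
    ≡⟨ ↭-length (filter-↭ (totals? k ℓ m) (patternWords↭histories n)) ⟩
  length (filter (totals? k ℓ m) (map patternWord (perms n)))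
    ≡⟨ length-filter-map _ (totals? k ℓ m) patternWord (perms n) (λ {w} w∈ → match w (perms-sound w∈)) ⟨
  D n k ℓ m ∎
  where
  open ≡-Reasoning
  match : ∀ w → IsPerm w → ⟦ (descents w + k ≟ n) ×-dec (pat31-2 w ≟ ℓ) ×-dec (pat2-31 w ≟ m) ⟧ ≡
                           ⟦ totals? k ℓ m (patternWord w) ⟧
  match w perm = ⟦⟧-cong _ (totals? k ℓ m (patternWord w))
    (λ (des , a , b) → +-cancelˡ-≡ (descents w) _ _ (trans (descents+ascents w perm) (sym des)) ,
                       trans (sym (pat31-2≡ w perm)) a , trans (sym (pat2-31≡ w perm)) b)
    (λ { (refl , a , b) → descents+ascents w perm , trans (pat31-2≡ w perm) a , trans (pat2-31≡ w perm) b })
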